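{- Let $k\geq 2$ be an integer. For any real number $\delta>0$, there exists an $n_0$ such that for all $n\geq n_0$, $$t\bigl(n, GR_{k-1}(K_3)-1\bigr)\leq f_{k}(n, K_3)<t\bigl(n, GR_{k-1}(K_3)-1\bigr)+\delta n^2.$$
   Context: A $k$-edge-coloring of a graph is a map from its edge set to $[k]=\{1,\dots,k\}$ (not necessarily proper). A subgraph is rainbow if all its edges have distinct colors and monochromatic if all its edges have the same color. A Gallai-$k$-coloring is a $k$-edge-coloring of a complete graph containing no rainbow triangle. For a graph $H$ and positive integer $k$, the Gallai-Ramsey number $GR_k(H)$ is the minimum integer $N$ such that every Gallai-$k$-coloring of $K_N$ contains a monochromatic copy of $H$. For $k\geq 2$, $f_k(n,H)$ denotes the maximum, over all $k$-edge-colorings of $K_n$, of the number of edges that are contained in no rainbow triangle and in no monochromatic copy of $H$. $t(n,r)$ denotes the number of edges of the Turán graph $T_r(n)$, the complete $r$-partite graph on $n$ vertices with part sizes as equal as possible. -}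

module Defs where

open import Data.Nat using (ℕ; zero; suc; _+_; _*_; _∸_; _≤_; _<_; _⊔_; _%_)
open import Data.Nat.Properties using (_≟_)
open import Data.Fin using (Fin; toℕ; _<?_) renaming (_≟_ to _≟ᶠ_)
open import Data.List using (List; []; _∷_; map; concatMap; length; filterᵇ; foldr; allFin)
open import Data.Bool using (Bool; true; false; _∧_; _∨_; not)
open import Data.Product using (∃-syntax; _×_)
open import Relation.Nullary using (¬_; does)
open import Relation.Binary.PropositionalEquality using (_≡_; _≢_)

-- A k-edge-coloring of K_n (vertex set Fin n).  We represent it by a
-- function c : Fin n → Fin n → Fin k; the colour of the edge {i,j}
-- (i ≢ j) is read off as c at (min, max), so only the values c i j with
-- i < j matter (see 'col').
Coloring : ℕ → ℕ → Set
Coloring k n = Fin n → Fin n → Fin k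

col : ∀ {k n} → Coloring k n → Fin n → Fin n → Fin k
col c i j with does (i <? j)
... | true  = c i j
... | false = c j i

RainbowTri : ∀ {k n} → Coloring k n → Fin n → Fin n → Fin n → Set
RainbowTri c i j l =
  (i ≢ j) × (i ≢ l) × (j ≢ l) ×
  (col c i j ≢ col c i l) × (col c i j ≢ col c j l) × (col c i l ≢ col c j l)

MonoTri : ∀ {k n} → Coloring k n → Fin n → Fin n → Fin n → Set
MonoTri c i j l =
  (i ≢ j) × (i ≢ l) × (j ≢ l) ×
  (col c i j ≡ col c i l) × (col c i j ≡ col c j l)

Gallai : ∀ {k n} → Coloring k n → Set
Gallai c = ∀ i j l → ¬ RainbowTri c i j l

HasMonoTri : ∀ {k n} → Coloring k n → Set
HasMonoTri {n = n} c = ∃[ i ] ∃[ j ] ∃[ l ] MonoTri c i j l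

GRArrows : ℕ → ℕ → Set
GRArrows k N = (c : Coloring k N) → Gallai c → HasMonoTri c

IsGR : ℕ → ℕ → Set
IsGR k N = GRArrows k N × (∀ M → GRArrows k M → N ≤ M)

_≠ᵇ_ : ∀ {n} → Fin n → Fin n → Bool
a ≠ᵇ b = not (does (a ≟ᶠ b))

_==ᵇ_ : ∀ {n} → Fin n → Fin n → Bool
a ==ᵇ b = does (a ≟ᶠ b)

rainbowᵇ : ∀ {k n} → Coloring k n → Fin n → Fin n → Fin n → Bool
rainbowᵇ c i j l =
  (i ≠ᵇ j) ∧ (i ≠ᵇ l) ∧ (j ≠ᵇ l) ∧
  (col c i j ≠ᵇ col c i l) ∧ (col c i j ≠ᵇ col c j l) ∧ (col c i l ≠ᵇ col c j l)

monoᵇ : ∀ {k n} → Coloring k n → Fin n → Fin n → Fin n → Bool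
monoᵇ c i j l =
  (i ≠ᵇ j) ∧ (i ≠ᵇ l) ∧ (j ≠ᵇ l) ∧
  (col c i j ==ᵇ col c i l) ∧ (col c i j ==ᵇ col c j l)

allᵇ : ∀ {A : Set} → (A → Bool) → List A → Bool
allᵇ p = foldr (λ x b → p x ∧ b) true

goodEdgeᵇ : ∀ {k n} → Coloring k n → Fin n → Fin n → Bool
goodEdgeᵇ {n = n} c i j =
  allᵇ (λ l → not (rainbowᵇ c i j l) ∧ not (monoᵇ c i j l)) (allFin n)

record Pair (n : ℕ) : Set where
  constructor _,_
  field
    fst : Fin n
    snd : Fin n

edges : (n : ℕ) → List (Pair n)
edges n = concatMap (λ i → map (λ j → i , j) (filterᵇ (λ j → does (i <? j)) (allFin n))) (allFin n)

goodCount : ∀ {k n} → Coloring k n → ℕ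
goodCount {n = n} c = length (filterᵇ (λ e → goodEdgeᵇ c (Pair.fst e) (Pair.snd e)) (edges n))

allFuns : ∀ {A : Set} (m : ℕ) → List A → List (Fin m → A)
allFuns zero    xs = (λ ()) ∷ []
allFuns (suc m) xs =
  concatMap (λ a → map (λ f → λ { Fin.zero → a ; (Fin.suc x) → f x }) (allFuns m xs)) xs

allColorings : (k n : ℕ) → List (Coloring k n)
allColorings k n = allFuns n (allFuns n (allFin k))

maximum : List ℕ → ℕ
maximum = foldr _⊔_ 0

f : ℕ → ℕ → ℕ
f k n = maximum (map goodCount (allColorings k n))

-- Turán number t(n, r): edges of the complete r-partite graph T_r(n) with
-- parts as equal as possible.  Realisation: vertex i ∈ Fin n goes to part
-- (i mod r); parts then have sizes ⌊n/r⌋ or ⌈n/r⌉.  For r = 0 (which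
-- never occurs in the theorem) we set t(n,0) = 0.
t : ℕ → ℕ → ℕ
t n zero    = 0
t n (suc r) = length (filterᵇ
  (λ e → not (does ((toℕ (Pair.fst e) % suc r) ≟ (toℕ (Pair.snd e) % suc r))))
  (edges n))

{-# OPTIONS --safe #-}
module Submission where

-- By induction on the vertices, a Gallai colouring without monochromatic triangles either
-- uses at most two colours or has a colour with a disconnected graph. In the second case a minimal
-- union of components is a module, which can be contracted; in the first case there are at most
-- R(3,3) - 1 = 5 vertices. Hence Σ_v 1 / g (palette v) ≤ 1, where palette v is the number of
-- colours seen by v and g s + 1 = GR_s(K₃). Hence K_N with N = g (k - 1) + 1 has no such
-- k-colouring in which every vertex misses some colour.
--
-- Lower bound: blow up an extremal (k - 1)-colouring and use the k-th colour inside the parts.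
--
-- Upper bound: if ux and vx are good edges of colour a then uv does not have colour a. Averaging over
-- x and induction on the colours show that at most q^k vertices have good degree ≥ n/q in every
-- colour. Give every other vertex u a colour γ(u) of good degree < n/q, and delete the good edges
-- uv of colour γ(u) or γ(v). At the vertices of a remaining clique the colour γ is missing, so the
-- remaining graph is K_N-free and Turán's theorem applies; only n²/q + O(n) edges were deleted.

module GallaiRamsey where

  open import Data.Bool using (Bool; true; false)
  open import Data.Fin using (Fin; zero; suc; toℕ; fromℕ<; inject≤; splitAt; _↑ˡ_; _↑ʳ_; remQuot; combine)
    renaming (_<_ to _<ᶠ_; _<?_ to _<?ᶠ_)
  open import Data.Fin.Properties as Finₚ
    using (_≟_; <-cmp; suc-injective; toℕ<n; toℕ-injective; toℕ-fromℕ<; inject≤-injective;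
           splitAt-↑ˡ; splitAt-↑ʳ; ↑ˡ-injective; ↑ʳ-injective; combine-remQuot)
  open import Data.List using (List; []; _∷_; _++_; length; map; concatMap; filter; filterᵇ; allFin)
  open import Data.List.Properties using (length-tabulate)
  open import Data.List.Membership.Propositional using (_∈_; find; lose)
  open import Data.List.Membership.Propositional.Properties using (∈-allFin; ∈-map⁺; ∈-concatMap⁺; ∈-filter⁺; ∈-filter⁻)
  open import Data.List.Relation.Unary.All as All using (All; []; _∷_)
  open import Data.List.Relation.Unary.AllPairs using ([]; _∷_)
  open import Data.List.Relation.Unary.Any using (Any; here; there; any?)
  open import Data.List.Relation.Unary.Unique.Propositional using (Unique)
  open import Data.List.Relation.Unary.Unique.Propositional.Properties using (allFin⁺; filter⁺)
  open import Data.Nat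
    using (ℕ; zero; suc; _+_; _*_; _^_; _∸_; ∣_-_∣; _/_; _%_; _≤_; _<_; z≤n; s≤s; NonZero; >-nonZero)
    renaming (_≟_ to _≟ⁿ_; _<?_ to _<?ⁿ_)
  open import Data.Nat.DivMod using (_mod_; m≡m%n+[m/n]*n; m/n*n≤m; /-monoˡ-≤)
  open import Data.Nat.Properties hiding (_≟_; _<?_; <-cmp; suc-injective)
  open import Data.Nat.Tactic.RingSolver using (solve-∀)
  open import Data.Product using (_×_; _,_; ∃-syntax; proj₁; proj₂)
  open import Data.Sum using (_⊎_; inj₁; inj₂; [_,_]′; swap)
  open import Defs
    using (Coloring; col; RainbowTri; MonoTri; Gallai; HasMonoTri; GRArrows; IsGR;
           Pair; edges; goodEdgeᵇ; allᵇ; goodCount; allFuns; allColorings; maximum; f; t)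
  open import Function using (_∘_; id; case_of_)
  open import Relation.Binary.Definitions using (DecidableEquality; Tri; tri<; tri≈; tri>)
  open import Relation.Binary.PropositionalEquality
  open import Relation.Nullary using (¬_; Dec; does; yes; no; contradiction)
  open import Relation.Nullary.Decidable
    using (¬?; _×-dec_; _⊎-dec_; _→-dec_; map′; decidable-stable; dec-true; dec-false; from-yes)
  open import Relation.Unary using (Decidable)

  -- Indicators and finite sums

  private variable
    A B : Set
    S T U : Set

  𝟙 : Dec S → ℕ
  𝟙 (yes _) = 1
  𝟙 (no  _) = 0

  𝟙≤1 : (p : Dec S) → 𝟙 p ≤ 1
  𝟙≤1 (yes _) = ≤-refl
  𝟙≤1 (no  _) = z≤n

  𝟙-yes : (p : Dec S) → S → 𝟙 p ≡ 1
  𝟙-yes (yes _) _ = refl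
  𝟙-yes (no ¬p) p = contradiction p ¬p

  𝟙-no : (p : Dec S) → ¬ S → 𝟙 p ≡ 0
  𝟙-no (yes p) ¬p = contradiction p ¬p
  𝟙-no (no  _) _  = refl

  𝟙-mono : (p : Dec S) (q : Dec T) → (S → T) → 𝟙 p ≤ 𝟙 q
  𝟙-mono (no  _) q _ = z≤n
  𝟙-mono (yes p) q h = ≤-reflexive (sym (𝟙-yes q (h p)))

  𝟙-disjoint : (p : Dec S) (q : Dec T) (r : Dec U) →
               (S → U) → (T → U) → (S → ¬ T) → 𝟙 p + 𝟙 q ≤ 𝟙 r
  𝟙-disjoint (yes p) (yes q) r f g d = contradiction q (d p)
  𝟙-disjoint (yes p) (no  _) r f g d = ≤-reflexive (sym (𝟙-yes r (f p)))
  𝟙-disjoint (no  _) q       r f g d = 𝟙-mono q r g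

  ∑ : List A → (A → ℕ) → ℕ
  ∑ []       f = 0
  ∑ (x ∷ xs) f = f x + ∑ xs f

  ∑-mono : (xs : List A) {f g : A → ℕ} → (∀ {x} → x ∈ xs → f x ≤ g x) → ∑ xs f ≤ ∑ xs g
  ∑-mono []       h = z≤n
  ∑-mono (x ∷ xs) h = +-mono-≤ (h (here refl)) (∑-mono xs (h ∘ there))

  ∑-mono′ : (xs : List A) {f g : A → ℕ} → (∀ x → f x ≤ g x) → ∑ xs f ≤ ∑ xs g
  ∑-mono′ xs h = ∑-mono xs (λ {x} _ → h x)

  ∑-cong : (xs : List A) {f g : A → ℕ} → (∀ x → f x ≡ g x) → ∑ xs f ≡ ∑ xs g
  ∑-cong []       h = refl
  ∑-cong (x ∷ xs) h = cong₂ _+_ (h x) (∑-cong xs h)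

  ∑-+ : (xs : List A) (f g : A → ℕ) → ∑ xs (λ x → f x + g x) ≡ ∑ xs f + ∑ xs g
  ∑-+ []       f g = refl
  ∑-+ (x ∷ xs) f g rewrite ∑-+ xs f g = interchange (f x) (g x) (∑ xs f) (∑ xs g)
    where
    interchange : ∀ a b c d → a + b + (c + d) ≡ a + c + (b + d)
    interchange = solve-∀

  ∑-*ˡ : (xs : List A) (m : ℕ) (f : A → ℕ) → ∑ xs (λ x → m * f x) ≡ m * ∑ xs f
  ∑-*ˡ []       m f = sym (*-zeroʳ m)
  ∑-*ˡ (x ∷ xs) m f rewrite ∑-*ˡ xs m f = sym (*-distribˡ-+ m (f x) _)

  ∑-const : (xs : List A) (m : ℕ) → ∑ xs (λ _ → m) ≡ length xs * m
  ∑-const []       m = refl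
  ∑-const (x ∷ xs) m = cong (m +_) (∑-const xs m)

  ∑-≤const : (xs : List A) {f : A → ℕ} {m : ℕ} → (∀ x → f x ≤ m) → ∑ xs f ≤ length xs * m
  ∑-≤const xs {m = m} h = ≤-trans (∑-mono′ xs h) (≤-reflexive (∑-const xs m))

  ∑-swap : (xs : List A) (ys : List B) (f : A → B → ℕ) →
           ∑ xs (λ x → ∑ ys (f x)) ≡ ∑ ys (λ y → ∑ xs (λ x → f x y))
  ∑-swap []       ys f = sym (trans (∑-const ys 0) (*-zeroʳ (length ys)))
  ∑-swap (x ∷ xs) ys f = trans (cong (∑ ys (f x) +_) (∑-swap xs ys f)) (sym (∑-+ ys (f x) _))

  module _ {P : A → Set} (P? : Decidable P) where

    ∑-filter : (xs : List A) (f : A → ℕ) →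
               ∑ xs f ≡ ∑ (filter P? xs) f + ∑ (filter (¬? ∘ P?) xs) f
    ∑-filter []       f = refl
    ∑-filter (x ∷ xs) f with P? x
    ... | yes _ = trans (cong (f x +_) (∑-filter xs f)) (sym (+-assoc (f x) _ _))
    ... | no  _ = trans (cong (f x +_) (∑-filter xs f)) (rotate (f x) (∑ (filter P? xs) f) _)
      where
      rotate : ∀ a b c → a + (b + c) ≡ b + (a + c)
      rotate = solve-∀

    length-filter+ : (xs : List A) →
                     length (filter P? xs) + length (filter (¬? ∘ P?) xs) ≡ length xs
    length-filter+ []       = refl
    length-filter+ (x ∷ xs) with P? x
    ... | yes _ = cong suc (length-filter+ xs)
    ... | no  _ = trans (+-suc _ _) (cong suc (length-filter+ xs))

    length-filter≡∑ : (xs : List A) → length (filter P? xs) ≡ ∑ xs (λ x → 𝟙 (P? x))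
    length-filter≡∑ []       = refl
    length-filter≡∑ (x ∷ xs) with P? x
    ... | yes _ = cong suc (length-filter≡∑ xs)
    ... | no  _ = length-filter≡∑ xs

  ∑-member : {xs : List A} {x : A} {f : A → ℕ} → x ∈ xs → f x ≤ ∑ xs f
  ∑-member (here refl) = m≤m+n _ _
  ∑-member (there x∈)  = m≤n⇒m≤o+n _ (∑-member x∈)

  length-allFin : ∀ n → length (allFin n) ≡ n
  length-allFin n = length-tabulate (id {A = Fin n})

  ∑𝟙≤1 : {P : A → Set} (P? : Decidable P) {xs : List A} → Unique xs →
         (∀ {x y} → P x → P y → x ≡ y) → ∑ xs (λ x → 𝟙 (P? x)) ≤ 1
  ∑𝟙≤1 P? []       h = z≤n
  ∑𝟙≤1 P? {x ∷ xs} (x∉xs ∷ u) h with P? x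
  ... | no  _  = ∑𝟙≤1 P? u h
  ... | yes px = s≤s (≤-trans (∑-mono xs none) (≤-reflexive (trans (∑-const xs 0) (*-zeroʳ (length xs)))))
    where
    none : ∀ {y} → y ∈ xs → 𝟙 (P? y) ≤ 0
    none {y} y∈ = ≤-reflexive (𝟙-no (P? y) (λ py → All.lookup x∉xs y∈ (h px py)))

  -- Double counting over the values of `φ`: each value is taken by at most one entry satisfying
  -- `P`.
  ∑𝟙-pigeonhole : {P : A → Set} (P? : Decidable P) {xs : List A} {m : ℕ} → Unique xs →
                  (φ : A → Fin m) → (∀ {x y} → P x → P y → φ x ≡ φ y → x ≡ y) →
                  ∑ xs (λ x → 𝟙 (P? x)) ≤ m
  ∑𝟙-pigeonhole P? {xs} {m} u φ inj = begin
    ∑ xs (λ x → 𝟙 (P? x))                                        ≤⟨ ∑-mono′ xs hit ⟩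
    ∑ xs (λ x → ∑ (allFin m) (λ d → 𝟙 (P? x ×-dec φ x ≟ d)))   ≡⟨ ∑-swap xs (allFin m) _ ⟩
    ∑ (allFin m) (λ d → ∑ xs (λ x → 𝟙 (P? x ×-dec φ x ≟ d)))   ≤⟨ ∑-≤const (allFin m) fibre ⟩
    length (allFin m) * 1                                        ≡⟨ *-identityʳ _ ⟩
    length (allFin m)                                            ≡⟨ length-allFin m ⟩
    m                                                            ∎
    where
    open ≤-Reasoning
    hit : ∀ x → 𝟙 (P? x) ≤ ∑ (allFin m) (λ d → 𝟙 (P? x ×-dec φ x ≟ d))
    hit x = ≤-trans (𝟙-mono (P? x) (P? x ×-dec φ x ≟ φ x) (_, refl)) (∑-member (∈-allFin (φ x)))
    fibre : ∀ d → ∑ xs (λ x → 𝟙 (P? x ×-dec φ x ≟ d)) ≤ 1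
    fibre d = ∑𝟙≤1 (λ x → P? x ×-dec φ x ≟ d) u
                (λ { (px , refl) (py , eq) → inj px py (sym eq) })

  -- Turán's theorem

  maximiser : (h : A → ℕ) (x : A) (xs : List A) →
              ∃[ v ] (v ∈ x ∷ xs × (∀ {y} → y ∈ x ∷ xs → h y ≤ h v))
  maximiser h x [] = x , here refl , λ { (here refl) → ≤-refl }
  maximiser h x (y ∷ ys) with maximiser h y ys
  ... | v , v∈ , max with ≤-total (h v) (h x)
  ...   | inj₁ v≤x = x , here refl , λ { (here refl) → ≤-refl ; (there z∈) → ≤-trans (max z∈) v≤x }
  ...   | inj₂ x≤v = v , there v∈ , λ { (here refl) → x≤v ; (there z∈) → max z∈ }

  2mn≤m²+n² : ∀ m n → 2 * (m * n) ≤ m * m + n * n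
  2mn≤m²+n² m n with ≤-total m n
  ... | inj₁ m≤n with o , refl ← m≤n⇒∃[o]m+o≡n m≤n =
    subst (2 * (m * n) ≤_) (identity m o) (m≤m+n _ (o * o))
    where
    identity : ∀ m o → 2 * (m * (m + o)) + o * o ≡ m * m + (m + o) * (m + o)
    identity = solve-∀
  ... | inj₂ n≤m with o , refl ← m≤n⇒∃[o]m+o≡n n≤m =
    subst (2 * (m * n) ≤_) (identity n o) (m≤m+n _ (o * o))
    where
    identity : ∀ n o → 2 * ((n + o) * n) + o * o ≡ (n + o) * (n + o) + n * n
    identity = solve-∀

  module Turán (Adj : A → A → Set) (adj? : ∀ x y → Dec (Adj x y))
               (Adj-sym : ∀ {x y} → Adj x y → Adj y x) where

    -- The `e i` need not be distinct, so for `2 ≤ m` a loop `Adj x x` with `x ∈ V` is excluded as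
    -- well.
    CliqueFree : ℕ → List A → Set
    CliqueFree m V = (e : Fin m → A) → (∀ i → e i ∈ V) → ¬ (∀ {i j} → i ≢ j → Adj (e i) (e j))

    -- Ordered pairs are counted, so `edgesBetween V V` counts each edge of a loopless graph on `V`
    -- twice.
    edgesBetween : List A → List A → ℕ
    edgesBetween U V = ∑ U (λ x → ∑ V (λ y → 𝟙 (adj? x y)))

    edgesBetween-sym : ∀ U V → edgesBetween U V ≡ edgesBetween V U
    edgesBetween-sym U V = trans (∑-swap U V _)
      (∑-cong V λ y → ∑-cong U λ x → ≤-antisym (𝟙-mono (adj? x y) (adj? y x) Adj-sym)
                                                (𝟙-mono (adj? y x) (adj? x y) Adj-sym))

    private
      -- The slack is the square (d - (1 + s) e)².
      quadratic : ∀ s d e → (2 + s) * (s * (d * d) + (1 + s) * (2 * (e * d)))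
                            ≤ (1 + s) * ((1 + s) * ((d + e) * (d + e)))
      quadratic s d e = +-cancelʳ-≤ (d * d + (1 + s) * e * ((1 + s) * e)) _ _
        (≤-trans (≤-reflexive (identity s d e)) (+-monoʳ-≤ ((1 + s) * ((1 + s) * ((d + e) * (d + e)))) (2mn≤m²+n² d ((1 + s) * e))))
        where
        identity : ∀ s d e → (2 + s) * (s * (d * d) + (1 + s) * (2 * (e * d)))
                               + (d * d + (1 + s) * e * ((1 + s) * e))
                             ≡ (1 + s) * ((1 + s) * ((d + e) * (d + e))) + 2 * (d * ((1 + s) * e))
        identity = solve-∀

    -- Induction on the clique size. The neighbourhood `Γ` of a vertex of maximum degree `d` has
    -- smaller cliques; each of the `e` vertices outside `Γ` has degree at most `d`, so at most
    -- `e * d` edges are not inside `Γ`. Then `quadratic` gives the bound.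
    turán : ∀ s V → CliqueFree (2 + s) V → (1 + s) * edgesBetween V V ≤ s * (length V * length V)
    turán zero V free = ≤-reflexive (trans (+-identityʳ _) no-edges)
      where
      edge : ∀ {x y} → x ∈ V → y ∈ V → ¬ Adj x y
      edge {x} {y} x∈ y∈ xy = free e e∈ clique
        where
        e : Fin 2 → _
        e zero    = x
        e (suc _) = y
        e∈ : ∀ i → e i ∈ V
        e∈ zero    = x∈
        e∈ (suc _) = y∈
        clique : ∀ {i j} → i ≢ j → Adj (e i) (e j)
        clique {zero}     {zero}     i≢j = contradiction refl i≢j
        clique {zero}     {suc _}    _   = xy
        clique {suc _}    {zero}     _   = Adj-sym xy
        clique {suc zero} {suc zero} i≢j = contradiction refl i≢j
      no-edges : edgesBetween V V ≡ 0
      no-edges = n≤0⇒n≡0 (≤-trans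
        (∑-mono V {g = λ _ → 0} λ {x} x∈ → ≤-trans
          (∑-mono V {g = λ _ → 0} λ {y} y∈ → ≤-reflexive (𝟙-no (adj? x y) (edge x∈ y∈)))
          (≤-reflexive (trans (∑-const V 0) (*-zeroʳ (length V)))))
        (≤-reflexive (trans (∑-const V 0) (*-zeroʳ (length V)))))
    turán (suc s) [] free = ≤-trans (≤-reflexive (*-zeroʳ (2 + s))) z≤n
    turán (suc s) V@(x ∷ xs) free with maximiser (λ y → ∑ V (λ z → 𝟙 (adj? y z))) x xs
    -- The extra factor `1 + s` is the coefficient with which the induction hypothesis bounds the
    -- edges inside `Γ`.
    ... | v , v∈ , max = *-cancelˡ-≤ (1 + s) (begin
        (1 + s) * ((2 + s) * edgesBetween V V)
          ≤⟨ *-monoʳ-≤ (1 + s) (*-monoʳ-≤ (2 + s) split) ⟩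
        (1 + s) * ((2 + s) * (edgesBetween Γ Γ + 2 * (e * d)))
          ≡⟨ rearrange s (edgesBetween Γ Γ) (2 * (e * d)) ⟩
        (2 + s) * ((1 + s) * edgesBetween Γ Γ + (1 + s) * (2 * (e * d)))
          ≤⟨ *-monoʳ-≤ (2 + s) (+-monoˡ-≤ _ (turán s Γ free′)) ⟩
        (2 + s) * (s * (d * d) + (1 + s) * (2 * (e * d)))
          ≤⟨ quadratic s d e ⟩
        (1 + s) * ((1 + s) * ((d + e) * (d + e)))
          ≡⟨ cong (λ m → (1 + s) * ((1 + s) * (m * m))) (length-filter+ (adj? v) V) ⟩
        (1 + s) * ((1 + s) * (length V * length V)) ∎)
      where
      open ≤-Reasoning
      Γ = filter (adj? v) V
      Γᶜ = filter (¬? ∘ adj? v) V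
      d = length Γ
      e = length Γᶜ
      rearrange : ∀ s b c → (1 + s) * ((2 + s) * (b + c)) ≡ (2 + s) * ((1 + s) * b + (1 + s) * c)
      rearrange = solve-∀
      splitʳ : ∀ U → edgesBetween U V ≡ edgesBetween U Γ + edgesBetween U Γᶜ
      splitʳ U = trans (∑-cong U λ x → ∑-filter (adj? v) V _) (∑-+ U _ _)
      Γᶜ≤ : edgesBetween Γᶜ V ≤ e * d
      Γᶜ≤ = ≤-trans
        (∑-mono Γᶜ λ {y} y∈ → ≤-trans (max (proj₁ (∈-filter⁻ (¬? ∘ adj? v) {xs = V} y∈)))
                                     (≤-reflexive (sym (length-filter≡∑ (adj? v) V))))
        (≤-reflexive (∑-const Γᶜ d))
      ΓΓᶜ≤ : edgesBetween Γ Γᶜ ≤ e * d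
      ΓΓᶜ≤ = begin
        edgesBetween Γ Γᶜ                     ≡⟨ edgesBetween-sym Γ Γᶜ ⟩
        edgesBetween Γᶜ Γ                     ≤⟨ m≤m+n _ _ ⟩
        edgesBetween Γᶜ Γ + edgesBetween Γᶜ Γᶜ  ≡⟨ splitʳ Γᶜ ⟨
        edgesBetween Γᶜ V                     ≤⟨ Γᶜ≤ ⟩
        e * d                                ∎
      split : edgesBetween V V ≤ edgesBetween Γ Γ + 2 * (e * d)
      split = begin
        edgesBetween V V                                        ≡⟨ ∑-filter (adj? v) V _ ⟩
        edgesBetween Γ V + edgesBetween Γᶜ V                     ≡⟨ cong (_+ edgesBetween Γᶜ V) (splitʳ Γ) ⟩
        edgesBetween Γ Γ + edgesBetween Γ Γᶜ + edgesBetween Γᶜ V  ≤⟨ +-mono-≤ (+-monoʳ-≤ _ ΓΓᶜ≤) Γᶜ≤ ⟩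
        edgesBetween Γ Γ + e * d + e * d                        ≡⟨ double (edgesBetween Γ Γ) (e * d) ⟩
        edgesBetween Γ Γ + 2 * (e * d)                          ∎
        where
        double : ∀ a b → a + b + b ≡ a + 2 * b
        double = solve-∀
      free′ : CliqueFree (2 + s) Γ
      free′ c c∈ clique = free c′ c′∈ clique′
        where
        c′ : Fin (3 + s) → _
        c′ zero    = v
        c′ (suc i) = c i
        c′∈ : ∀ i → c′ i ∈ V
        c′∈ zero    = v∈
        c′∈ (suc i) = proj₁ (∈-filter⁻ (adj? v) {xs = V} (c∈ i))
        vc : ∀ i → Adj v (c i)
        vc i = proj₂ (∈-filter⁻ (adj? v) {xs = V} (c∈ i))
        clique′ : ∀ {i j} → i ≢ j → Adj (c′ i) (c′ j)
        clique′ {zero}  {zero}  i≢j = contradiction refl i≢j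
        clique′ {zero}  {suc j} _   = vc j
        clique′ {suc i} {zero}  _   = Adj-sym (vc i)
        clique′ {suc i} {suc j} i≢j = clique (i≢j ∘ cong suc)

  -- Decomposition of Gallai colourings

  -- The diagonal values χ x x are junk.
  record IsGallai {A : Set} {k : ℕ} (χ : A → A → Fin k) : Set where
    field
      symm      : ∀ x y → χ x y ≡ χ y x
      noRainbow : ∀ {x y z} → x ≢ y → x ≢ z → y ≢ z →
                  χ x y ≢ χ x z → χ x y ≢ χ y z → ¬ χ x z ≢ χ y z

  record IsGallaiTriangleFree {A : Set} {k : ℕ} (χ : A → A → Fin k) : Set where
    field
      isGallai : IsGallai χ
      noMono   : ∀ {x y z} → x ≢ y → x ≢ z → y ≢ z → χ x y ≡ χ x z → ¬ χ x y ≡ χ y z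
    open IsGallai isGallai public

  module Gallai {A : Set} (_≟ᴬ_ : DecidableEquality A) {k : ℕ} {χ : A → A → Fin k} (G : IsGallai χ) where
    open IsGallai G

    third : ∀ {x y z} → y ≢ z → x ≢ y → x ≢ z → χ x y ≢ χ x z → χ y z ≡ χ x y ⊎ χ y z ≡ χ x z
    third {x} {y} {z} y≢z x≢y x≢z ne with χ y z ≟ χ x y | χ y z ≟ χ x z
    ... | yes p | _     = inj₁ p
    ... | no  _ | yes q = inj₂ q
    ... | no ¬p | no ¬q = contradiction (¬q ∘ sym) (noRainbow x≢y x≢z y≢z ne (¬p ∘ sym))

    -- Within `L`, `P` is a union of connected components of the graph of colour `i`.
    record Closed (i : Fin k) (L : List A) : Set₁ where
      field
        P      : A → Set
        P?     : Decidable P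
        closed : ∀ {a b} → a ∈ L → b ∈ L → P a → ¬ P b → χ a b ≢ i

    -- A module in the sense of modular decomposition that is also a union of components of colour
    -- `i`; adding a vertex below uses both properties together.
    record Module (i : Fin k) (L : List A) : Set₁ where
      field
        closedSet : Closed i L
      open Closed closedSet public
      field
        homogeneous : ∀ {u a b} → u ∈ L → a ∈ L → b ∈ L → ¬ P u → P a → P b → χ u a ≡ χ u b

    complement : ∀ {i L} → Closed i L → Closed i L
    complement C = record
      { P      = ¬_ ∘ P
      ; P?     = ¬? ∘ P?
      ; closed = λ {a} {b} a∈ b∈ ¬pa ¬¬pb eq →
          closed b∈ a∈ (decidable-stable (P? b) ¬¬pb) ¬pa (trans (symm b a) eq)
      }
      where open Closed C

    -- If u ∉ P does not see P in one colour, the part of P seen in the colour χ u w is again closed: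
    -- an edge of colour i leaving it inside P would form a rainbow triangle with u.
    module-around : ∀ {i L} (C : Closed i L) → let open Closed C in
                    ∀ {w} → w ∈ L → P w →
                    ∃[ M ] (Module.P {i} {L} M w × (∀ {a} → Module.P M a → P a))
    module-around {i} {L} C {w} w∈ pw = go (suc (length (filter (Closed.P? C) L))) C pw ≤-refl
      where
      -- The counter `m` exceeds the number of entries of `L` in `P`; each refinement discards at
      -- least the witness `a`.
      go : ∀ m (C : Closed i L) → let open Closed C in P w → length (filter P? L) < m →
           ∃[ M ] (Module.P {i} {L} M w × (∀ {a} → Module.P M a → P a))
      go (suc m) C pw (s≤s le)
        with any? (λ u → ¬? (Closed.P? C u) ×-dec any? (λ a → Closed.P? C a ×-dec ¬? (χ u a ≟ χ u w)) L) L
      ... | no none = record { closedSet = C ; homogeneous = hom } , pw , λ p → p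
        where
        open Closed C
        same : ∀ {u a} → u ∈ L → a ∈ L → ¬ P u → P a → χ u a ≡ χ u w
        same u∈ a∈ ¬pu pa =
          decidable-stable (_ ≟ _) λ ne → none (lose u∈ (¬pu , lose a∈ (pa , ne)))
        hom : ∀ {u a b} → u ∈ L → a ∈ L → b ∈ L → ¬ P u → P a → P b → χ u a ≡ χ u b
        hom u∈ a∈ b∈ ¬pu pa pb = trans (same u∈ a∈ ¬pu pa) (sym (same u∈ b∈ ¬pu pb))
      ... | yes some with find some
      ...   | u , u∈ , ¬pu , some′ with find some′
      ...     | a , a∈ , pa , ne =
        let M , pM , M⊆ = go m C′ (pw , refl) (≤-trans smaller le) in M , pM , λ p → proj₁ (M⊆ p)
        where
        open Closed C
        P′ : A → Set
        P′ b = P b × χ u b ≡ χ u w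
        P′? : Decidable P′
        P′? b = P? b ×-dec (χ u b ≟ χ u w)
        closed′ : ∀ {b c} → b ∈ L → c ∈ L → P′ b → ¬ P′ c → χ b c ≢ i
        closed′ {b} {c} b∈ c∈ (pb , eq) ¬p′c with P? c
        ... | no ¬pc = closed b∈ c∈ pb ¬pc
        ... | yes pc = λ bc≡i →
          [ (λ e → closed b∈ u∈ pb ¬pu (trans (symm b u) (trans (sym e) bc≡i)))
          , (λ e → closed c∈ u∈ pc ¬pu (trans (symm c u) (trans (sym e) bc≡i)))
          ]′ (third (λ { refl → ¬p′c (pb , eq) }) (λ { refl → ¬pu pb }) (λ { refl → ¬pu pc })
                    (λ e → ¬p′c (pc , trans (sym e) eq)))
        C′ : Closed i L
        C′ = record { P = P′ ; P? = P′? ; closed = closed′ }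
        smaller : length (filter P′? L) < length (filter P? L)
        smaller = filter-smaller a∈
          where
          weaken : ∀ xs → length (filter P′? xs) ≤ length (filter P? xs)
          weaken xs = ≤-trans (≤-reflexive (length-filter≡∑ P′? xs))
            (≤-trans (∑-mono′ xs λ x → 𝟙-mono (P′? x) (P? x) proj₁)
                     (≤-reflexive (sym (length-filter≡∑ P? xs))))
          filter-smaller : ∀ {xs} → a ∈ xs → length (filter P′? xs) < length (filter P? xs)
          filter-smaller {x ∷ xs} (here refl) with P? a | χ u a ≟ χ u w
          ... | no ¬pa | _     = contradiction pa ¬pa
          ... | yes _  | yes e = contradiction e ne
          ... | yes _  | no _  = s≤s (weaken xs)
          filter-smaller {x ∷ xs} (there a∈′) with P? x | χ u x ≟ χ u w
          ... | no _  | _     = filter-smaller a∈′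
          ... | yes _ | yes _ = s≤s (filter-smaller a∈′)
          ... | yes _ | no _  = m≤n⇒m≤1+n (filter-smaller a∈′)

    -- The edge `x y` rules out a colour that does not occur in `L`. Its ends lie in one component,
    -- which later yields two vertices of a module.
    record Disconnected (L : List A) : Set₁ where
      field
        i   : Fin k
        x y : A
        x∈  : x ∈ L
        y∈  : y ∈ L
        x≢y : x ≢ y
        xy  : χ x y ≡ i
        cut : Closed i L
      open Closed cut public
      field
        a b : A
        a∈  : a ∈ L
        b∈  : b ∈ L
        pa  : P a
        ¬pb : ¬ P b

    side : ∀ {L} (D : Disconnected L) w →
           ∃[ C ] (Closed.P {Disconnected.i D} {L} C w × ∃[ z ] (z ∈ L × ¬ Closed.P C z))
    side D w with Disconnected.P? D w
    ... | yes pw = cut , pw , b , b∈ , ¬pb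
      where open Disconnected D
    ... | no ¬pw = complement cut , ¬pw , a , a∈ , λ ¬pa → ¬pa pa
      where open Disconnected D

    TwoColoured : List A → Set
    TwoColoured L = ∃[ p ] ∃[ q ] (∀ {x y} → x ∈ L → y ∈ L → x ≢ y → χ x y ≡ p ⊎ χ x y ≡ q)

    private
      module Extend {v : A} {W : List A} (v∉W : All (v ≢_) W) where

        v≢ : ∀ {w} → w ∈ W → v ≢ w
        v≢ = All.lookup v∉W

        -- Colour `i` occurs in `W` but not at `v`, so `v` alone is a component.
        isolated : ∀ {i x y} → x ∈ W → y ∈ W → x ≢ y → χ x y ≡ i →
                   (∀ {w} → w ∈ W → χ v w ≢ i) → Disconnected (v ∷ W)
        isolated {i} {x} {y} x∈ y∈ x≢y xy none = record
          { i = i ; x = x ; y = y ; x∈ = there x∈ ; y∈ = there y∈ ; x≢y = x≢y ; xy = xy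
          ; cut = record
            { P = _≡ v ; P? = _≟ᴬ v
            ; closed = λ { _ (here refl) _ ¬b → contradiction refl ¬b
                         ; _ (there b∈) refl _ → none b∈ } }
          ; a = v ; b = x ; a∈ = here refl ; b∈ = there x∈ ; pa = refl ; ¬pb = v≢ x∈ ∘ sym
          }

        -- An edge of `W` in a third colour leaves `v` isolated in that colour; without such an edge
        -- `i` and `j` suffice.
        finish : ∀ i j → (∀ {w} → w ∈ W → χ v w ≡ i ⊎ χ v w ≡ j) →
                 TwoColoured (v ∷ W) ⊎ Disconnected (v ∷ W)
        finish i j vW with any? (λ x → any? (λ y → ¬? (x ≟ᴬ y) ×-dec ¬? (χ x y ≟ i ⊎-dec χ x y ≟ j)) W) W
        ... | yes some with find some
        ...   | x , x∈ , some′ with find some′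
        ...     | y , y∈ , x≢y , ne =
          inj₂ (isolated x∈ y∈ x≢y refl λ w∈ e → ne
            ([ (λ vi → inj₁ (trans (sym e) vi)) , (λ vj → inj₂ (trans (sym e) vj)) ]′ (vW w∈)))
        finish i j vW | no none = inj₁ (i , j , two)
          where
          two : ∀ {x y} → x ∈ v ∷ W → y ∈ v ∷ W → x ≢ y → χ x y ≡ i ⊎ χ x y ≡ j
          two (here refl) (here refl) x≢y = contradiction refl x≢y
          two (here refl) (there y∈)  _   = vW y∈
          two {x} (there x∈) (here refl) _ rewrite symm x v = vW x∈
          two {x} {y} (there x∈) (there y∈) x≢y =
            decidable-stable (χ x y ≟ i ⊎-dec χ x y ≟ j) λ ne → none (lose x∈ (lose y∈ (x≢y , ne)))

        -- If `v` sees `w` in a new colour, all edges of this colour end at `v`. A vertex `w′` that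
        -- `v` sees in another colour is then isolated in it; if there is none, `v` sees one colour
        -- only.
        extend₁ : TwoColoured W → TwoColoured (v ∷ W) ⊎ Disconnected (v ∷ W)
        extend₁ (p , q , pq) with any? (λ w → ¬? (χ v w ≟ p ⊎-dec χ v w ≟ q)) W
        ... | no none = finish p q λ {w} w∈ →
          decidable-stable (χ v w ≟ p ⊎-dec χ v w ≟ q) λ ne → none (lose w∈ ne)
        ... | yes some with find some
        ...   | w , w∈ , ne with any? (λ w′ → ¬? (χ v w′ ≟ χ v w)) W
        -- Here `p` only fills the second place: every edge at `v` has colour `χ v w`.
        ...     | no none = finish (χ v w) p λ {w′} w′∈ →
          inj₁ (decidable-stable (χ v w′ ≟ χ v w) λ ne′ → none (lose w′∈ ne′))
        ...     | yes some′ with find some′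
        ...       | w′ , w′∈ , ne′ = inj₂ (record
          { i = χ v w ; x = v ; y = w ; x∈ = here refl ; y∈ = there w∈ ; x≢y = v≢ w∈ ; xy = refl
          ; cut = record { P = _≡ w′ ; P? = _≟ᴬ w′ ; closed = closed }
          ; a = w′ ; b = v ; a∈ = there w′∈ ; b∈ = here refl ; pa = refl ; ¬pb = v≢ w′∈
          })
          where
          closed : ∀ {a b} → a ∈ v ∷ W → b ∈ v ∷ W → a ≡ w′ → b ≢ w′ → χ a b ≢ χ v w
          closed _ (here refl) refl _ e = ne′ (trans (symm v w′) e)
          closed {b = b} _ (there b∈) refl b≢ e =
            ne ([ (λ ep → inj₁ (trans (sym e) ep)) , (λ eq → inj₂ (trans (sym e) eq)) ]′
                  (pq w′∈ b∈ (b≢ ∘ sym)))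

        module _ (D : Disconnected W) where
          open Disconnected D using (i; x; y; x∈; y∈; x≢y; xy)

          private
            -- Nothing is known about `P v`, so `v` is placed explicitly on the other side.
            extendCut : (C : Closed i W) → let open Closed C in
                        (∀ {d} → d ∈ W → P d → χ v d ≢ i) → Closed i (v ∷ W)
            extendCut C none = record
              { P = λ a → a ≢ v × P a ; P? = λ a → ¬? (a ≟ᴬ v) ×-dec P? a ; closed = closed′ }
              where
              open Closed C
              closed′ : ∀ {a b} → a ∈ v ∷ W → b ∈ v ∷ W → a ≢ v × P a → ¬ (b ≢ v × P b) → χ a b ≢ i
              closed′ (here refl) _           (a≢ , _)  _   = contradiction refl a≢
              closed′ {a} (there a∈)  (here refl) (_ , pa) _ e = none a∈ pa (trans (symm v a) e)
              closed′ (there a∈)  (there b∈)  (_ , pa) ¬b   =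
                closed a∈ b∈ pa (λ pb → ¬b (v≢ b∈ ∘ sym , pb))

            one-sided : (C : Closed i W) → let open Closed C in
                        ∀ {d} → d ∈ W → P d →
                        (∀ {d} → d ∈ W → P d → χ v d ≢ i) → Disconnected (v ∷ W)
            one-sided C {d} d∈ pd none = record
              { i = i ; x = x ; y = y ; x∈ = there x∈ ; y∈ = there y∈ ; x≢y = x≢y ; xy = xy
              ; cut = extendCut C none
              ; a = d ; b = v ; a∈ = there d∈ ; b∈ = here refl
              ; pa = v≢ d∈ ∘ sym , pd ; ¬pb = λ p → proj₁ p refl }

            -- If `v` sends no edge of colour `i` into the closed set, the set stays closed when `v`
            -- is added and cuts off `v`.
            neighbour : (C : Closed i W) → let open Closed C in ∀ {d} → d ∈ W → P d →
                        Disconnected (v ∷ W) ⊎ ∃[ d ] (d ∈ W × P d × χ v d ≡ i)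
            neighbour C d∈ pd with any? (λ d → Closed.P? C d ×-dec χ v d ≟ i) W
            ... | yes some = let d , d∈ , pd , e = find some in inj₂ (d , d∈ , pd , e)
            ... | no none = inj₁ (one-sided C d∈ pd λ d∈ pd e → none (lose d∈ (pd , e)))

          record Component (w : A) : Set₁ where
            field
              M      : Module i W
            open Module M public
            field
              pw     : P w
              d e    : A
              d∈     : d ∈ W
              e∈     : e ∈ W
              pd     : P d
              ¬pe    : ¬ P e
              vd     : χ v d ≡ i
              ve     : χ v e ≡ i

          -- The module comes from the side of the cut containing `w`; `neighbour` for the module
          -- and for its complement gives `d` and `e`, unless colour `i` stays disconnected.
          component : ∀ {w} → w ∈ W → Disconnected (v ∷ W) ⊎ Component w
          component {w} w∈ = around (side D w)
            where
            around : ∃[ C ] (Closed.P {i} {W} C w × ∃[ b ] (b ∈ W × ¬ Closed.P C b)) →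
                     Disconnected (v ∷ W) ⊎ Component w
            around (C , pw , b , b∈ , ¬pb) with module-around C w∈ pw
            ... | M , pMw , M⊆C with neighbour (Module.closedSet M) w∈ pMw
                                  | neighbour (complement (Module.closedSet M)) b∈ (¬pb ∘ M⊆C)
            ... | inj₁ r | _ = inj₁ r
            ... | inj₂ _ | inj₁ r = inj₁ r
            ... | inj₂ (d , d∈ , pd , vd) | inj₂ (e , e∈ , ¬pe , ve) = inj₂ (record
                  { M = M ; pw = pMw ; d = d ; e = e ; d∈ = d∈ ; e∈ = e∈ ; pd = pd ; ¬pe = ¬pe ; vd = vd ; ve = ve })

          module _ {w w′} (w∈ : w ∈ W) (w′∈ : w′ ∈ W) (vw : χ v w ≢ i) (vw′ : χ v w′ ≢ i)
                   (ne : χ v w ≢ χ v w′) (K : Component w) where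
            open Component K

            -- For `u` in the module with `v u` not of colour `i`, closedness keeps colour `i` off
            -- `e u`, so the triangle `v`, `e`, `u` gives `e u` the colour of `v u`. As `e` sees the
            -- module in one colour, `w` and `w′` cannot both lie in it.
            not-same : ¬ P w′
            not-same pw′ = ne (trans (sym (other w∈ vw pw)) (trans (homogeneous e∈ w∈ w′∈ ¬pe pw pw′) (other w′∈ vw′ pw′)))
              where
              other : ∀ {u} → u ∈ W → χ v u ≢ i → P u → χ e u ≡ χ v u
              other {u} u∈ vu pu =
                [ (λ f → contradiction (trans (symm u e) (trans f ve)) (closed u∈ e∈ pu ¬pe))
                , (λ f → f)
                ]′ (third (λ { refl → ¬pe pu }) (v≢ e∈) (v≢ u∈) (λ f → vu (trans (sym f) ve)))

            -- Otherwise `w′` sees the whole module, in particular `d`, in the colour of `v w`.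
            -- Since `v d` has colour `i`, the triangle `v`, `d`, `w′` would be rainbow.
            not-first : ¬ P w′ → χ w w′ ≢ χ v w
            not-first ¬pw′ f =
              [ (λ g → vw (trans (sym g′) (trans g vd)))
              , (λ g → ne (trans (sym g′) g))
              ]′ (third (λ { refl → ¬pw′ pd }) (v≢ d∈) (v≢ w′∈) (λ g → vw′ (trans (sym g) vd)))
              where
              g′ : χ d w′ ≡ χ v w
              g′ = trans (symm d w′) (trans (homogeneous w′∈ d∈ w∈ ¬pw′ pd pw) (trans (symm w′ w) f))

          -- The edge `w w′` must have the colour of `v w` or of `v w′`; `not-first`, used also with
          -- the two roles exchanged, excludes both.
          two-at-v : ∀ {w w′} → w ∈ W → w′ ∈ W → χ v w ≢ i → χ v w′ ≢ i → χ v w ≢ χ v w′ →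
                     Disconnected (v ∷ W)
          two-at-v {w} {w′} w∈ w′∈ vw vw′ ne with component w∈ | component w′∈
          ... | inj₁ r | _      = r
          ... | inj₂ _ | inj₁ r = r
          ... | inj₂ K | inj₂ K′ = contradiction (third w≢w′ (v≢ w∈) (v≢ w′∈) ne)
            [ not-first w∈ w′∈ vw vw′ ne K (not-same w∈ w′∈ vw vw′ ne K)
            , not-first w′∈ w∈ vw′ vw (ne ∘ sym) K′ (not-same w′∈ w∈ vw′ vw (ne ∘ sym) K′) ∘ trans (symm w′ w)
            ]′
            where
            w≢w′ : w ≢ w′
            w≢w′ refl = ne refl

          extend₂ : TwoColoured (v ∷ W) ⊎ Disconnected (v ∷ W)
          extend₂ with any? (λ w → ¬? (χ v w ≟ i)) W
          ... | no none = finish i i λ {w} w∈ → inj₁ (decidable-stable (χ v w ≟ i) λ ne → none (lose w∈ ne))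
          ... | yes some with find some
          ...   | w , w∈ , vw with any? (λ w′ → ¬? (χ v w′ ≟ i ⊎-dec χ v w′ ≟ χ v w)) W
          ...     | no none = finish i (χ v w) λ {w′} w′∈ →
            decidable-stable (χ v w′ ≟ i ⊎-dec χ v w′ ≟ χ v w) λ ne → none (lose w′∈ ne)
          ...     | yes some′ with find some′
          ...       | w′ , w′∈ , ne = inj₂ (two-at-v w∈ w′∈ vw (ne ∘ inj₁) (ne ∘ inj₂ ∘ sym))

    -- Gallai's theorem on disconnected colours, by adding one vertex at a time. The argument `p`
    -- supplies the two colours for the empty list.
    twoColoured⊎disconnected : Fin k → ∀ {L} → Unique L → TwoColoured L ⊎ Disconnected L
    twoColoured⊎disconnected p []      = inj₁ (p , p , λ ())
    twoColoured⊎disconnected p (v∉ ∷ u) with twoColoured⊎disconnected p u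
    ... | inj₁ two = Extend.extend₁ v∉ two
    ... | inj₂ D   = Extend.extend₂ v∉ D

    -- Two distinct vertices inside and one outside make both the module and the list with the
    -- module contracted shorter than `L`.
    record ProperModule (L : List A) : Set₁ where
      field
        P  : A → Set
        P? : Decidable P
        homogeneous : ∀ {u a b} → u ∈ L → a ∈ L → b ∈ L → ¬ P u → P a → P b → χ u a ≡ χ u b
        x y z : A
        x∈  : x ∈ L
        y∈  : y ∈ L
        z∈  : z ∈ L
        x≢y : x ≢ y
        px  : P x
        py  : P y
        ¬pz : ¬ P z

    -- The module around `x` misses the vertices beyond the cut, and contains `y` because the edge
    -- `x y` of colour `i` cannot leave a closed set.
    disconnected⇒module : ∀ {L} → Disconnected L → ProperModule L
    disconnected⇒module {L} D = around (side D x)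
      where
      open Disconnected D using (i; x; y; x∈; y∈; x≢y; xy)
      around : ∃[ C ] (Closed.P {i} {L} C x × ∃[ z ] (z ∈ L × ¬ Closed.P C z)) → ProperModule L
      around (C , px , z , z∈ , ¬pz) with module-around C x∈ px
      ... | M , pMx , M⊆C = record
        { P = P ; P? = P? ; homogeneous = homogeneous
        ; x = x ; y = y ; z = z ; x∈ = x∈ ; y∈ = y∈ ; z∈ = z∈ ; x≢y = x≢y
        ; px = pMx ; py = decidable-stable (P? y) (λ ¬py → closed x∈ y∈ pMx ¬py xy) ; ¬pz = ¬pz ∘ M⊆C }
        where open Module M

  -- A Kraft inequality for colourings without monochromatic triangles

  module TriangleFree {A : Set} (_≟ᴬ_ : DecidableEquality A) {k : ℕ} {χ : A → A → Fin k}
                      (G : IsGallaiTriangleFree χ) where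
    open IsGallaiTriangleFree G
    open Gallai _≟ᴬ_ isGallai

    Sees : List A → A → Fin k → Set
    Sees L v c = Any (λ u → u ≢ v × χ v u ≡ c) L

    sees? : ∀ L v → Decidable (Sees L v)
    sees? L v c = any? (λ u → ¬? (u ≟ᴬ v) ×-dec χ v u ≟ c) L

    palette : List A → A → ℕ
    palette L v = ∑ (allFin k) (λ c → 𝟙 (sees? L v c))

    1≤palette : ∀ {L v c} → Sees L v c → 1 ≤ palette L v
    1≤palette {L} {v} {c} s = ≤-trans (≤-reflexive (sym (𝟙-yes (sees? L v c) s))) (∑-member (∈-allFin c))

    2≤palette : ∀ {L v c d} → Sees L v c → Sees L v d → c ≢ d → 2 ≤ palette L v
    2≤palette {L} {v} {c} {d} sc sd c≢d = begin
      2                                                          ≤⟨ +-mono-≤ (one c) (one d) ⟩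
      ∑ (allFin k) (λ e → 𝟙 (e ≟ c)) + ∑ (allFin k) (λ e → 𝟙 (e ≟ d))  ≡⟨ ∑-+ (allFin k) _ _ ⟨
      ∑ (allFin k) (λ e → 𝟙 (e ≟ c) + 𝟙 (e ≟ d))                 ≤⟨ ∑-mono′ (allFin k) (λ e →
          𝟙-disjoint (e ≟ c) (e ≟ d) (sees? L v e) (λ { refl → sc }) (λ { refl → sd }) (λ { refl → c≢d })) ⟩
      palette L v                                                ∎
      where
      open ≤-Reasoning
      one : ∀ c → 1 ≤ ∑ (allFin k) (λ e → 𝟙 (e ≟ c))
      one c = ≤-trans (≤-reflexive (sym (𝟙-yes (c ≟ c) refl))) (∑-member (∈-allFin c))

    -- An edge of colour `c` inside `U` would close a monochromatic triangle with `v`. So all edges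
    -- inside `U` have colour `c′`, and three vertices would form a monochromatic triangle.
    two-coloured-neighbourhood : ∀ {v c c′} (U : List A) → Unique U →
      (∀ {u} → u ∈ U → v ≢ u × χ v u ≡ c) →
      (∀ {x y} → x ∈ U → y ∈ U → x ≢ y → χ x y ≡ c ⊎ χ x y ≡ c′) → length U ≤ 2
    two-coloured-neighbourhood [] _ _ _ = z≤n
    two-coloured-neighbourhood (_ ∷ []) _ _ _ = s≤s z≤n
    two-coloured-neighbourhood (_ ∷ _ ∷ []) _ _ _ = ≤-refl
    two-coloured-neighbourhood {v} {c} {c′} U@(x ∷ y ∷ z ∷ _) ((x≢y ∷ x≢z ∷ _) ∷ (y≢z ∷ _) ∷ _) nbr two =
      contradiction (trans (other x∈ y∈ x≢y) (sym (other y∈ z∈ y≢z)))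
                    (noMono x≢y x≢z y≢z (trans (other x∈ y∈ x≢y) (sym (other x∈ z∈ x≢z))))
      where
      x∈ : x ∈ U
      x∈ = here refl
      y∈ : y ∈ U
      y∈ = there (here refl)
      z∈ : z ∈ U
      z∈ = there (there (here refl))
      other : ∀ {a b} → a ∈ U → b ∈ U → a ≢ b → χ a b ≡ c′
      other a∈ b∈ a≢b with two a∈ b∈ a≢b
      ... | inj₂ e = e
      ... | inj₁ e = let v≢a , va = nbr a∈ ; v≢b , vb = nbr b∈ in
        contradiction (trans va (sym e)) (noMono v≢a v≢b a≢b (trans va (sym vb)))

    -- The bound `R(3,3) ≤ 6`: a vertex has at most two neighbours in each colour.
    twoColoured⇒length≤5 : ∀ {L} → Unique L → TwoColoured L → length L ≤ 5
    twoColoured⇒length≤5 {[]}    _        _             = z≤n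
    twoColoured⇒length≤5 {v ∷ W} (v∉ ∷ u) (p , q , two) = s≤s (begin
      length W                                                     ≡⟨ length-filter+ p? W ⟨
      length (filter p? W) + length (filter (¬? ∘ p?) W)           ≤⟨ +-mono-≤ ps qs ⟩
      4                                                            ∎)
      where
      open ≤-Reasoning
      p? : Decidable (λ w → χ v w ≡ p)
      p? w = χ v w ≟ p
      ps : length (filter p? W) ≤ 2
      ps = two-coloured-neighbourhood {c′ = q} (filter p? W) (filter⁺ p? u)
        (λ u∈ → let u∈W , e = ∈-filter⁻ p? {xs = W} u∈ in All.lookup v∉ u∈W , e)
        (λ x∈ y∈ → two (there (proj₁ (∈-filter⁻ p? {xs = W} x∈))) (there (proj₁ (∈-filter⁻ p? {xs = W} y∈))))
      qs : length (filter (¬? ∘ p?) W) ≤ 2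
      qs = two-coloured-neighbourhood {c′ = p} (filter (¬? ∘ p?) W) (filter⁺ (¬? ∘ p?) u)
        (λ u∈ → let u∈W , ne = ∈-filter⁻ (¬? ∘ p?) {xs = W} u∈ ; v≢u = All.lookup v∉ u∈W in
          v≢u , [ (λ e → contradiction e ne) , (λ e → e) ]′ (two (here refl) (there u∈W) v≢u))
        (λ x∈ y∈ x≢y → swap (two (there (proj₁ (∈-filter⁻ (¬? ∘ p?) {xs = W} x∈)))
                                 (there (proj₁ (∈-filter⁻ (¬? ∘ p?) {xs = W} y∈))) x≢y))

    two-others : ∀ {L} → Unique L → 3 ≤ length L → ∀ v →
                 ∃[ x ] ∃[ y ] (x ∈ L × y ∈ L × x ≢ y × x ≢ v × y ≢ v)
    two-others {a ∷ b ∷ c ∷ _} ((a≢b ∷ a≢c ∷ _) ∷ (b≢c ∷ _) ∷ _) _ v with a ≟ᴬ v | b ≟ᴬ v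
    ... | yes refl | _        = b , c , there (here refl) , there (there (here refl)) , b≢c , a≢b ∘ sym , a≢c ∘ sym
    ... | no a≢v   | yes refl = a , c , here refl , there (there (here refl)) , a≢c , a≢v , b≢c ∘ sym
    ... | no a≢v   | no b≢v   = a , b , here refl , there (here refl) , a≢b , a≢v , b≢v
    two-others {_ ∷ []} _ (s≤s ()) _
    two-others {_ ∷ _ ∷ []} _ (s≤s (s≤s ())) _

    -- If some `v` sees all other vertices in one colour, these form a module. Otherwise every
    -- palette has at least two colours, and the decomposition leaves a module or a two-coloured
    -- list.
    module⊎prime : ∀ {L} → Unique L → 3 ≤ length L →
                   ProperModule L ⊎ (length L ≤ 5 × (∀ {v} → v ∈ L → 2 ≤ palette L v))
    module⊎prime {L} u 3≤L
      with any? (λ v → ¬? (any? (λ x → any? (λ y → (¬? (x ≟ᴬ v) ×-dec ¬? (y ≟ᴬ v)) ×-dec ¬? (χ v x ≟ χ v y)) L) L)) L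
    ... | yes some = let v , v∈ , same = find some ; x , y , x∈ , y∈ , x≢y , x≢v , y≢v = two-others u 3≤L v in
      inj₁ (record
        { P = _≢ v ; P? = λ a → ¬? (a ≟ᴬ v)
        ; homogeneous = λ {w} {a} {b} w∈ a∈ b∈ ¬w≢v a≢v b≢v → case decidable-stable (w ≟ᴬ v) ¬w≢v of
            λ { refl → decidable-stable (χ w a ≟ χ w b) λ ne → same (lose a∈ (lose b∈ ((a≢v , b≢v) , ne))) }
        ; x = x ; y = y ; z = v ; x∈ = x∈ ; y∈ = y∈ ; z∈ = v∈ ; x≢y = x≢y
        ; px = x≢v ; py = y≢v ; ¬pz = λ v≢v → v≢v refl })
    ... | no none with twoColoured⊎disconnected (colour L 3≤L) u
      where
      colour : ∀ L → 3 ≤ length L → Fin k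
      -- Any colour will do; the junk diagonal value is at hand because `L` is nonempty.
      colour (a ∷ _) _ = χ a a
    ...   | inj₂ D   = inj₁ (disconnected⇒module D)
    ...   | inj₁ two = inj₂ (twoColoured⇒length≤5 u two , λ {v} v∈ →
      let x , x∈ , some = find (decidable-stable
            (any? (λ x → any? (λ y → (¬? (x ≟ᴬ v) ×-dec ¬? (y ≟ᴬ v)) ×-dec ¬? (χ v x ≟ χ v y)) L) L)
            (λ same → none (lose v∈ same)))
          y , y∈ , (x≢v , y≢v) , ne = find some
      in 2≤palette (lose x∈ (x≢v , refl)) (lose y∈ (y≢v , refl)) ne)

    -- `W₂` settles lists of two vertices and makes `W` nonincreasing; `W₅` settles prime lists,
    -- which have at most five vertices and palettes of size at least 2.
    module Kraft (W : ℕ → ℕ) (W₂ : ∀ s → 2 * W (1 + s) ≤ W s) (W₅ : ∀ s → 5 * W (2 + s) ≤ W s) where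

      W-suc : ∀ s → W (suc s) ≤ W s
      W-suc s = ≤-trans (m≤m+n _ _) (W₂ s)

      W-anti : ∀ {a b} → a ≤ b → W b ≤ W a
      W-anti {a} {b} a≤b with o , refl ← m≤n⇒∃[o]m+o≡n a≤b = go o
        where
        go : ∀ o → W (a + o) ≤ W a
        go zero    = ≤-reflexive (cong W (+-identityʳ a))
        go (suc o) = ≤-trans (≤-reflexive (cong W (+-suc a o))) (≤-trans (W-suc (a + o)) (go o))

      -- With W s = 1 / g s this is a Kraft inequality Σ_v 1 / g (palette v) ≤ 1. The shift t
      -- accounts for the colours a vertex sees outside the module under consideration.
      kraft : ∀ m t L → length L < m → Unique L → ∑ L (λ v → W (t + palette L v)) ≤ W t
      kraft _ t [] _ _ = z≤n
      kraft _ t (a ∷ []) _ _ = ≤-trans (≤-reflexive (+-identityʳ _)) (W-anti (m≤m+n t _))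
      kraft _ t L@(a ∷ b ∷ []) _ ((a≢b ∷ []) ∷ _) = ≤-trans
        (+-mono-≤ (one {a} (there (here (a≢b ∘ sym , refl)))) (+-monoˡ-≤ 0 (one {b} (here (a≢b , refl))))) (W₂ t)
        where
        one : ∀ {v c} → Sees L v c → W (t + palette L v) ≤ W (1 + t)
        one {v} s = W-anti (≤-trans (≤-reflexive (+-comm 1 t)) (+-monoʳ-≤ t (1≤palette s)))
      kraft (suc m) t L@(_ ∷ _ ∷ _ ∷ _) (s≤s L≤m) u with module⊎prime u (s≤s (s≤s (s≤s z≤n)))
      ... | inj₂ (L≤5 , two) = begin
        ∑ L (λ v → W (t + palette L v))  ≤⟨ ∑-mono L (λ v∈ → W-anti (≤-trans (≤-reflexive (+-comm 2 t)) (+-monoʳ-≤ t (two v∈)))) ⟩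
        ∑ L (λ _ → W (2 + t))            ≡⟨ ∑-const L (W (2 + t)) ⟩
        length L * W (2 + t)             ≤⟨ *-monoˡ-≤ (W (2 + t)) L≤5 ⟩
        5 * W (2 + t)                    ≤⟨ W₅ t ⟩
        W t                              ∎
        where open ≤-Reasoning
      ... | inj₁ M = begin
        ∑ L (λ v → W (t + palette L v))
          ≡⟨ ∑-filter P? L _ ⟩
        ∑ C (λ v → W (t + palette L v)) + ∑ O (λ v → W (t + palette L v))
          ≤⟨ +-mono-≤ (∑-mono C (λ v∈ → W-anti (inner v∈))) (∑-mono O (λ {v} _ → W-anti (+-monoʳ-≤ t (palette-mono v L′⊆L)))) ⟩
        ∑ C (λ v → W (t + palette L′ x + palette C v)) + ∑ O (λ v → W (t + palette L′ v))
          -- The shift is chosen so that the bound for the module `C` is exactly the term of its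
          -- representative `x` in the sum over the contracted list `L′`.
          ≤⟨ +-monoˡ-≤ _ (kraft m (t + palette L′ x) C C< (filter⁺ P? u)) ⟩
        ∑ L′ (λ v → W (t + palette L′ v))
          ≤⟨ kraft m t L′ L′< u′ ⟩
        W t ∎
        where
        open ≤-Reasoning
        open ProperModule M
        C = filter P? L
        O = filter (¬? ∘ P?) L
        L′ = x ∷ O
        C⇒ : ∀ {v} → v ∈ C → v ∈ L × P v
        C⇒ = ∈-filter⁻ P? {xs = L}
        O⇒ : ∀ {v} → v ∈ O → v ∈ L × ¬ P v
        O⇒ = ∈-filter⁻ (¬? ∘ P?) {xs = L}
        L′⊆L : ∀ {v} → v ∈ L′ → v ∈ L
        L′⊆L (here refl) = x∈
        L′⊆L (there v∈)  = proj₁ (O⇒ v∈)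
        nonempty : ∀ {v} {xs : List A} → v ∈ xs → 1 ≤ length xs
        nonempty {xs = _ ∷ _} _ = s≤s z≤n
        2≤C : 2 ≤ length C
        2≤C = two-in C (∈-filter⁺ P? x∈ px) (∈-filter⁺ P? y∈ py)
          where
          two-in : ∀ xs → x ∈ xs → y ∈ xs → 2 ≤ length xs
          two-in (_ ∷ [])     (here refl) (here refl) = contradiction refl x≢y
          two-in (_ ∷ _ ∷ _) _ _ = s≤s (s≤s z≤n)
        C< : length C < m
        C< = ≤-trans (≤-trans (≤-reflexive (+-comm 1 (length C)))
                              (+-monoʳ-≤ (length C) (nonempty (∈-filter⁺ (¬? ∘ P?) z∈ ¬pz))))
                     (≤-trans (≤-reflexive (length-filter+ P? L)) L≤m)
        L′< : length L′ < m
        L′< = ≤-trans (+-monoˡ-≤ (length O) 2≤C) (≤-trans (≤-reflexive (length-filter+ P? L)) L≤m)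
        u′ : Unique L′
        u′ = All.tabulate (λ { v∈ refl → proj₂ (O⇒ v∈) px }) ∷ filter⁺ (¬? ∘ P?) u
        palette-mono : ∀ {L₁ L₂} v → (∀ {a} → a ∈ L₁ → a ∈ L₂) → palette L₁ v ≤ palette L₂ v
        palette-mono {L₁} {L₂} v sub = ∑-mono′ (allFin k) λ c → 𝟙-mono (sees? L₁ v c) (sees? L₂ v c)
          λ s → let u , u∈ , e = find s in lose (sub u∈) e
        -- A colour seen at v both inside and outside the module gives a monochromatic triangle.
        inner : ∀ {v} → v ∈ C → t + palette L′ x + palette C v ≤ t + palette L v
        inner {v} v∈ = begin
          t + palette L′ x + palette C v                                          ≡⟨ +-assoc t _ _ ⟩
          t + (palette L′ x + palette C v)                                        ≡⟨ cong (t +_) (∑-+ (allFin k) _ _) ⟨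
          t + ∑ (allFin k) (λ c → 𝟙 (sees? L′ x c) + 𝟙 (sees? C v c))  ≤⟨ +-monoʳ-≤ t (∑-mono′ (allFin k) λ c →
              𝟙-disjoint (sees? L′ x c) (sees? C v c) (sees? L v c) outside
                (λ s → let u , u∈ , e = find s in lose (proj₁ (C⇒ u∈)) e) clash) ⟩
          t + palette L v                                                         ∎
          where
          outer : ∀ {c} → Sees L′ x c → ∃[ w ] (w ∈ L × ¬ P w × (∀ {a} → a ∈ L → P a → χ a w ≡ c))
          outer s with find s
          ... | _ , here refl , x≢x , _ = contradiction refl x≢x
          ... | w , there w∈ , _ , e = let w∈L , ¬pw = O⇒ w∈ in
            w , w∈L , ¬pw , λ {a} a∈ pa → trans (symm a w) (trans (homogeneous w∈L a∈ x∈ ¬pw pa px) (trans (symm w x) e))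
          outside : ∀ {c} → Sees L′ x c → Sees L v c
          outside s = let w , w∈ , ¬pw , e = outer s ; v∈L , pv = C⇒ v∈ in
            lose w∈ ((λ eq → ¬pw (subst P (sym eq) pv)) , e v∈L pv)
          clash : ∀ {c} → Sees L′ x c → ¬ Sees C v c
          clash s s′ =
            let w , w∈ , ¬pw , e = outer s
                v∈L , pv = C⇒ v∈
                a , a∈C , a≢v , va = find s′
                a∈ , pa = C⇒ a∈C
            in noMono {v} {a} {w} (a≢v ∘ sym) (λ eq → ¬pw (subst P eq pv)) (λ eq → ¬pw (subst P eq pa))
                 (trans va (sym (e v∈L pv))) (trans va (sym (e a∈ pa)))

  -- The value of GR_k(K₃)

  -- g s + 1 = GR_s(K₃) for s ≥ 1.
  g : ℕ → ℕ
  g 0             = 1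
  g 1             = 2
  g (suc (suc s)) = 5 * g s

  1≤g : ∀ s → 1 ≤ g s
  1≤g 0             = s≤s z≤n
  1≤g 1             = s≤s z≤n
  1≤g (suc (suc s)) = ≤-trans (1≤g s) (m≤m+n (g s) _)

  2g≤g : ∀ s → 2 * g s ≤ g (suc s)
  2g≤g 0             = ≤-refl
  2g≤g 1             = s≤s (s≤s (s≤s (s≤s z≤n)))
  2g≤g (suc (suc s)) = ≤-trans (≤-reflexive (*-exchange 2 5 (g s))) (*-monoʳ-≤ 5 (2g≤g s))
    where
    *-exchange : ∀ a b c → a * (b * c) ≡ b * (a * c)
    *-exchange a b c = trans (sym (*-assoc a b c)) (trans (cong (_* c) (*-comm a b)) (*-assoc b a c))

  -- This is `g (K ∸ s)` for `s ≤ K`, an integral substitute for `g K / g s`. The value 0 beyond `K`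
  -- keeps `weight₂` and `weight₅` true for every `s`.
  weight : ℕ → ℕ → ℕ
  weight K       zero    = g K
  weight zero    (suc s) = 0
  weight (suc K) (suc s) = weight K s

  weight₂ : ∀ K s → 2 * weight K (1 + s) ≤ weight K s
  weight₂ zero          _       = z≤n
  weight₂ (suc K)       zero    = 2g≤g K
  weight₂ (suc K)       (suc s) = weight₂ K s

  weight₅ : ∀ K s → 5 * weight K (2 + s) ≤ weight K s
  weight₅ zero          _       = z≤n
  weight₅ (suc zero)    _       = z≤n
  weight₅ (suc (suc K)) zero    = ≤-refl
  weight₅ (suc (suc K)) (suc s) = weight₅ (suc K) s

  1≤weight : ∀ {K s} → s ≤ K → 1 ≤ weight K s
  1≤weight {K}     {zero}  _         = 1≤g K
  1≤weight {suc K} {suc s} (s≤s s≤K) = 1≤weight s≤K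

  module _ {N k : ℕ} {χ : Fin N → Fin N → Fin k} (G : IsGallaiTriangleFree χ) where
    open TriangleFree _≟_ G

    -- Palettes of size at most `K` give each vertex weight at least 1, and the Kraft inequality
    -- bounds the total weight by `g K`.
    size≤g : ∀ {K} → (∀ v → palette (allFin N) v ≤ K) → N ≤ g K
    size≤g {K} few = begin
      N                                                        ≡⟨ trans (*-identityʳ _) (length-allFin N) ⟨
      length (allFin N) * 1                                    ≡⟨ ∑-const (allFin N) 1 ⟨
      ∑ (allFin N) (λ _ → 1)                                   ≤⟨ ∑-mono′ (allFin N) (λ v → 1≤weight (few v)) ⟩
      ∑ (allFin N) (λ v → weight K (palette (allFin N) v))     ≤⟨ kraft _ 0 (allFin N) ≤-refl (allFin⁺ N) ⟩
      g K                                                      ∎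
      where
      open ≤-Reasoning
      open Kraft (weight K) (weight₂ K) (weight₅ K)

    size≤g-colours : N ≤ g k
    size≤g-colours = size≤g λ v → ≤-trans (∑-≤const (allFin k) (λ c → 𝟙≤1 (sees? (allFin N) v c)))
      (≤-reflexive (trans (*-identityʳ _) (length-allFin k)))

  -- The missing colour may vary with the vertex. It lies outside the palette, so every palette has
  -- at most `k` of the `k + 1` colours, and this is all that `size≤g` asks for.
  size≤g-missing : ∀ {N k} {χ : Fin N → Fin N → Fin (suc k)} → IsGallaiTriangleFree χ →
                   (γ : Fin N → Fin (suc k)) → (∀ {i j} → i ≢ j → χ i j ≢ γ i) → N ≤ g k
  size≤g-missing {N} {k} {χ} G γ miss = size≤g G λ v → +-cancelʳ-≤ 1 _ _ (begin
    palette (allFin N) v + 1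
      ≤⟨ +-monoʳ-≤ (palette (allFin N) v) (≤-trans (≤-reflexive (sym (𝟙-yes (γ v ≟ γ v) refl))) (∑-member (∈-allFin (γ v)))) ⟩
    palette (allFin N) v + ∑ (allFin (suc k)) (λ c → 𝟙 (c ≟ γ v))
      ≡⟨ ∑-+ (allFin (suc k)) (λ c → 𝟙 (sees? (allFin N) v c)) (λ c → 𝟙 (c ≟ γ v)) ⟨
    ∑ (allFin (suc k)) (λ c → 𝟙 (sees? (allFin N) v c) + 𝟙 (c ≟ γ v))
      ≤⟨ ∑-≤const (allFin (suc k)) (λ c → ≤-trans
           (𝟙-disjoint (sees? (allFin N) v c) (c ≟ γ v) (yes (refl {x = c})) (λ _ → refl) (λ _ → refl)
             λ s → λ { refl → let u , _ , u≢v , e = find s in miss (u≢v ∘ sym) e })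
           ≤-refl) ⟩
    length (allFin (suc k)) * 1
      ≡⟨ trans (*-identityʳ _) (length-allFin (suc k)) ⟩
    suc k
      ≡⟨ +-comm 1 k ⟩
    k + 1 ∎)
    where
    open ≤-Reasoning
    open TriangleFree _≟_ G

  -- Extremal colourings

  pullback : ∀ {A B : Set} {k} {χ : A → A → Fin k} (e : B → A) → (∀ {x y} → e x ≡ e y → x ≡ y) →
             IsGallaiTriangleFree χ → IsGallaiTriangleFree (λ x y → χ (e x) (e y))
  pullback e inj G = record
    { isGallai = record
      { symm      = λ x y → symm (e x) (e y)
      ; noRainbow = λ x≢y x≢z y≢z → noRainbow (x≢y ∘ inj) (x≢z ∘ inj) (y≢z ∘ inj) }
    ; noMono = λ x≢y x≢z y≢z → noMono (x≢y ∘ inj) (x≢z ∘ inj) (y≢z ∘ inj) }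
    where open IsGallaiTriangleFree G

  -- With the quantifiers over `Fin N` made explicit, the condition is decided by `check?`, so small
  -- colourings are verified by evaluation.
  fromCheck : ∀ {N k} {χ : Fin N → Fin N → Fin k} →
              (∀ x y → χ x y ≡ χ y x) →
              (∀ x y z → x ≢ y → x ≢ z → y ≢ z →
                 ¬ (χ x y ≢ χ x z × χ x y ≢ χ y z × χ x z ≢ χ y z) × ¬ (χ x y ≡ χ x z × χ x y ≡ χ y z)) →
              IsGallaiTriangleFree χ
  fromCheck sy h = record
    { isGallai = record
      { symm      = sy
      ; noRainbow = λ x≢y x≢z y≢z p q r → proj₁ (h _ _ _ x≢y x≢z y≢z) (p , q , r) }
    ; noMono = λ x≢y x≢z y≢z p q → proj₂ (h _ _ _ x≢y x≢z y≢z) (p , q) }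

  check? : ∀ {N k} (χ : Fin N → Fin N → Fin k) →
           Dec (∀ x y z → x ≢ y → x ≢ z → y ≢ z →
                 ¬ (χ x y ≢ χ x z × χ x y ≢ χ y z × χ x z ≢ χ y z) × ¬ (χ x y ≡ χ x z × χ x y ≡ χ y z))
  check? χ = Finₚ.all? λ x → Finₚ.all? λ y → Finₚ.all? λ z → ¬? (x ≟ y) →-dec (¬? (x ≟ z) →-dec (¬? (y ≟ z) →-dec
    (¬? (¬? (χ x y ≟ χ x z) ×-dec ¬? (χ x y ≟ χ y z) ×-dec ¬? (χ x z ≟ χ y z))
     ×-dec ¬? (χ x y ≟ χ x z ×-dec χ x y ≟ χ y z))))

  edge : Fin 2 → Fin 2 → Fin 1
  edge _ _ = zero

  edge-good : IsGallaiTriangleFree edge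
  edge-good = fromCheck (λ _ _ → refl) (from-yes (check? edge))

  -- Differences 1 and 4 are the sides of a 5-cycle, and 2 and 3 its diagonals: the colouring that
  -- shows `R(3,3) > 5`.
  pentagon : Fin 5 → Fin 5 → Fin 2
  pentagon x y with ∣ toℕ x - toℕ y ∣
  ... | 1 = zero
  ... | 4 = zero
  ... | _ = suc zero

  pentagon-good : IsGallaiTriangleFree pentagon
  pentagon-good = fromCheck (from-yes (Finₚ.all? λ x → Finₚ.all? λ y → pentagon x y ≟ pentagon y x)) (from-yes (check? pentagon))

  module Lexicographic {N p : ℕ} {φ : Fin N → Fin N → Fin p} (Φ : IsGallaiTriangleFree φ)
                       {B : Set} {q : ℕ} {χ : B → B → Fin q} (X : IsGallaiTriangleFree χ) where
    private
      module Φ = IsGallaiTriangleFree Φ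
      module X = IsGallaiTriangleFree X

    lex : Fin N × B → Fin N × B → Fin (p + q)
    lex (a , b) (a′ , b′) with a ≟ a′
    ... | yes _ = p ↑ʳ χ b b′
    ... | no  _ = φ a a′ ↑ˡ q

    ↑ˡ≢↑ʳ : ∀ {c : Fin p} {d : Fin q} → c ↑ˡ q ≢ p ↑ʳ d
    ↑ˡ≢↑ʳ {c} {d} e with trans (sym (splitAt-↑ˡ p c q)) (trans (cong (splitAt p) e) (splitAt-↑ʳ p q d))
    ... | ()

    lex-symm : ∀ x y → lex x y ≡ lex y x
    lex-symm (a , b) (a′ , b′) with a ≟ a′ | a′ ≟ a
    ... | yes _   | yes _  = cong (p ↑ʳ_) (X.symm b b′)
    ... | yes e   | no ne  = contradiction (sym e) ne
    ... | no ne   | yes e  = contradiction (sym e) ne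
    ... | no _    | no _   = cong (_↑ˡ q) (Φ.symm a a′)

    -- When exactly two of the vertices share a block, both edges to the third have the same outer
    -- colour.
    lex-noRainbow : ∀ x y z → x ≢ y → x ≢ z → y ≢ z →
                    lex x y ≢ lex x z → lex x y ≢ lex y z → ¬ lex x z ≢ lex y z
    lex-noRainbow (a , b) (a′ , b′) (a″ , b″) x≢y x≢z y≢z with a ≟ a′ | a ≟ a″ | a′ ≟ a″
    ... | yes refl | yes refl | no ne    = contradiction refl ne
    ... | yes refl | no ne    | yes refl = contradiction refl ne
    ... | no ne    | yes refl | yes refl = contradiction refl ne
    ... | yes refl | yes refl | yes refl = λ u v w →
      X.noRainbow (x≢y ∘ cong (a ,_)) (x≢z ∘ cong (a ,_)) (y≢z ∘ cong (a ,_))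
        (u ∘ cong (p ↑ʳ_)) (v ∘ cong (p ↑ʳ_)) (w ∘ cong (p ↑ʳ_))
    ... | yes refl | no _     | no _     = λ _ _ w → w refl
    ... | no _     | yes refl | no _     = λ _ v _ → v (cong (_↑ˡ q) (Φ.symm a a′))
    ... | no _     | no _     | yes refl = λ u _ _ → u refl
    ... | no n     | no n′    | no n″    = λ u v w →
      Φ.noRainbow n n′ n″ (u ∘ cong (_↑ˡ q)) (v ∘ cong (_↑ˡ q)) (w ∘ cong (_↑ˡ q))

    -- When exactly two of the vertices share a block, an inner and an outer colour occur, and
    -- `↑ˡ≢↑ʳ` keeps them apart.
    lex-noMono : ∀ x y z → x ≢ y → x ≢ z → y ≢ z → lex x y ≡ lex x z → ¬ lex x y ≡ lex y z
    lex-noMono (a , b) (a′ , b′) (a″ , b″) x≢y x≢z y≢z with a ≟ a′ | a ≟ a″ | a′ ≟ a″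
    ... | yes refl | yes refl | no ne    = contradiction refl ne
    ... | yes refl | no ne    | yes refl = contradiction refl ne
    ... | no ne    | yes refl | yes refl = contradiction refl ne
    ... | yes refl | yes refl | yes refl = λ u v →
      X.noMono (x≢y ∘ cong (a ,_)) (x≢z ∘ cong (a ,_)) (y≢z ∘ cong (a ,_))
        (↑ʳ-injective p _ _ u) (↑ʳ-injective p _ _ v)
    ... | yes refl | no _     | no _     = λ u _ → ↑ˡ≢↑ʳ (sym u)
    ... | no _     | yes refl | no _     = λ u _ → ↑ˡ≢↑ʳ u
    ... | no _     | no _     | yes refl = λ _ v → ↑ˡ≢↑ʳ v
    ... | no n     | no n′    | no n″    = λ u v →
      Φ.noMono n n′ n″ (↑ˡ-injective q _ _ u) (↑ˡ-injective q _ _ v)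

    lex-good : IsGallaiTriangleFree lex
    lex-good = record
      { isGallai = record { symm = lex-symm ; noRainbow = λ {x} {y} {z} → lex-noRainbow x y z }
      ; noMono   = λ {x} {y} {z} → lex-noMono x y z }

  -- Substituting a colouring into the vertices of the pentagon adds two colours and multiplies the
  -- order by five, as in the recursion of `g`.
  optimal : ∀ s → ∃[ χ ] (IsGallaiTriangleFree {Fin (g (suc s))} {suc s} χ)
  optimal 0 = edge , edge-good
  optimal 1 = pentagon , pentagon-good
  optimal (suc (suc s)) with optimal s
  ... | χ , X = _ , pullback (remQuot {5} (g (suc s))) remQuot-injective (Lexicographic.lex-good pentagon-good X)
    where
    remQuot-injective : ∀ {i j} → remQuot {5} (g (suc s)) i ≡ remQuot {5} (g (suc s)) j → i ≡ j
    remQuot-injective {i} {j} e = trans (sym (combine-remQuot {5} (g (suc s)) i))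
      (trans (cong (λ x → combine (proj₁ x) (proj₂ x)) e) (combine-remQuot {5} (g (suc s)) j))

  -- Edge colours and the Gallai-Ramsey number

  module _ {k n : ℕ} (c : Coloring k n) where

    col-< : ∀ {i j} → i <ᶠ j → col c i j ≡ c i j
    col-< {i} {j} i<j with does (i <?ᶠ j) | dec-true (i <?ᶠ j) i<j
    ... | _ | refl = refl

    col-≮ : ∀ {i j} → ¬ i <ᶠ j → col c i j ≡ c j i
    col-≮ {i} {j} i≮j with does (i <?ᶠ j) | dec-false (i <?ᶠ j) i≮j
    ... | _ | refl = refl

    col-symm : ∀ i j → col c i j ≡ col c j i
    col-symm i j with <-cmp i j
    ... | tri< i<j _ j≮i  = trans (col-< i<j) (sym (col-≮ j≮i))
    ... | tri≈ _ refl _   = refl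
    ... | tri> i≮j _ j<i  = trans (col-≮ i≮j) (sym (col-< j<i))

    col-of-symmetric : (∀ i j → c i j ≡ c j i) → ∀ i j → col c i j ≡ c i j
    col-of-symmetric sy i j with i <?ᶠ j
    ... | yes i<j = col-< i<j
    ... | no  i≮j = trans (col-≮ i≮j) (sy j i)

  -- A Gallai colouring of `g (suc s) + 1` vertices without monochromatic triangles would contradict
  -- `size≤g-colours`. If `N` were at most `g (suc s)`, the extremal colouring restricted to `N`
  -- vertices would refute the arrow relation.
  IsGR⇒≡ : ∀ {s N} → IsGR (suc s) N → N ≡ suc (g (suc s))
  IsGR⇒≡ {s} {N} (arrows , least) = ≤-antisym (least _ upper) (≰⇒> lower)
    where
    upper : GRArrows (suc s) (suc (g (suc s)))
    upper c gallai with Finₚ.any? (λ i → Finₚ.any? (λ j → Finₚ.any? (λ l →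
        ¬? (i ≟ j) ×-dec ¬? (i ≟ l) ×-dec ¬? (j ≟ l) ×-dec
        (col c i j ≟ col c i l) ×-dec (col c i j ≟ col c j l))))
    ... | yes mono = mono
    ... | no none  = contradiction (size≤g-colours {χ = col c} (record
      { isGallai = record
        { symm      = col-symm c
        ; noRainbow = λ x≢y x≢z y≢z p q r → gallai _ _ _ (x≢y , x≢z , y≢z , p , q , r) }
      ; noMono = λ x≢y x≢z y≢z p q → none (_ , _ , _ , x≢y , x≢z , y≢z , p , q) })) (<⇒≱ ≤-refl)
    lower : ¬ N ≤ g (suc s)
    lower N≤g = no-mono (arrows c gallai)
      where
      c : Coloring (suc s) N
      c i j = proj₁ (optimal s) (inject≤ i N≤g) (inject≤ j N≤g)
      C : IsGallaiTriangleFree c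
      C = pullback (λ i → inject≤ i N≤g) (inject≤-injective N≤g N≤g _ _) (proj₂ (optimal s))
      open IsGallaiTriangleFree C
      gallai : Gallai c
      gallai i j l (i≢j , i≢l , j≢l , p , q , r)
        rewrite col-of-symmetric c symm i j | col-of-symmetric c symm i l | col-of-symmetric c symm j l =
        noRainbow i≢j i≢l j≢l p q r
      no-mono : ¬ HasMonoTri c
      no-mono (i , j , l , i≢j , i≢l , j≢l , p , q)
        rewrite col-of-symmetric c symm i j | col-of-symmetric c symm i l | col-of-symmetric c symm j l =
        noMono i≢j i≢l j≢l p q

  -- The lower bound

  countᵇ : (A → Bool) → List A → ℕ
  countᵇ p xs = length (filterᵇ p xs)

  countᵇ-++ : (p : A → Bool) (xs ys : List A) → countᵇ p (xs ++ ys) ≡ countᵇ p xs + countᵇ p ys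
  countᵇ-++ p []       ys = refl
  countᵇ-++ p (x ∷ xs) ys with p x
  ... | true  = cong suc (countᵇ-++ p xs ys)
  ... | false = countᵇ-++ p xs ys

  countᵇ-concatMap : (p : B → Bool) (h : A → List B) (xs : List A) →
                     countᵇ p (concatMap h xs) ≡ ∑ xs (λ x → countᵇ p (h x))
  countᵇ-concatMap p h []       = refl
  countᵇ-concatMap p h (x ∷ xs) = trans (countᵇ-++ p (h x) _) (cong (countᵇ p (h x) +_) (countᵇ-concatMap p h xs))

  countᵇ-map-filter : {P Q : A → Set} (P? : Decidable P) (Q? : Decidable Q) (q : B → Bool) (h : A → B) →
                      (∀ x → q (h x) ≡ does (Q? x)) → (xs : List A) →
                      countᵇ q (map h (filterᵇ (does ∘ P?) xs)) ≡ ∑ xs (λ x → 𝟙 (P? x ×-dec Q? x))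
  countᵇ-map-filter P? Q? q h e [] = refl
  countᵇ-map-filter P? Q? q h e (x ∷ xs) with P? x
  ... | no _ = countᵇ-map-filter P? Q? q h e xs
  ... | yes _ with Q? x | q (h x) | e x
  ...   | yes _ | _ | refl = cong suc (countᵇ-map-filter P? Q? q h e xs)
  ...   | no _  | _ | refl = countᵇ-map-filter P? Q? q h e xs

  -- Brings `goodCount` and `t` into the form of double sums of indicators, so that they can be
  -- compared termwise.
  countᵇ-edges : ∀ {n} {R : Fin n → Fin n → Set} (R? : ∀ i j → Dec (R i j)) (p : Pair n → Bool) →
                 (∀ i j → p (Defs._,_ i j) ≡ does (R? i j)) →
                 countᵇ p (edges n) ≡ ∑ (allFin n) (λ i → ∑ (allFin n) (λ j → 𝟙 (i <?ᶠ j ×-dec R? i j)))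
  countᵇ-edges {n} R? p e = trans (countᵇ-concatMap p _ (allFin n))
    (∑-cong (allFin n) λ i → countᵇ-map-filter (i <?ᶠ_) (R? i) p _ (e i) (allFin n))

  SamePart : ∀ r {n} → Fin n → Fin n → Set
  SamePart r i j = toℕ i % suc r ≡ toℕ j % suc r

  samePart? : ∀ r {n} (i j : Fin n) → Dec (SamePart r i j)
  samePart? r i j = toℕ i % suc r ≟ⁿ toℕ j % suc r

  t≡ : ∀ n r → t n (suc r) ≡ ∑ (allFin n) (λ i → ∑ (allFin n) (λ j → 𝟙 (i <?ᶠ j ×-dec ¬? (samePart? r i j))))
  t≡ n r = countᵇ-edges {n} (λ i j → ¬? (samePart? r i j)) _ (λ _ _ → refl)

  module _ {k n : ℕ} (c : Coloring k n) where

    GoodAt : Fin n → Fin n → Fin n → Set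
    GoodAt i j l = ¬ RainbowTri c i j l × ¬ MonoTri c i j l

    Good : Fin n → Fin n → Set
    Good i j = ∀ l → GoodAt i j l

    -- The decision mirrors the Boolean test in `goodEdgeᵇ` conjunct by conjunct, so that the two
    -- agree by computation.
    goodAt? : ∀ i j l → Dec (GoodAt i j l)
    goodAt? i j l =
      ¬? (¬? (i ≟ j) ×-dec ¬? (i ≟ l) ×-dec ¬? (j ≟ l) ×-dec
          ¬? (col c i j ≟ col c i l) ×-dec ¬? (col c i j ≟ col c j l) ×-dec ¬? (col c i l ≟ col c j l))
      ×-dec
      ¬? (¬? (i ≟ j) ×-dec ¬? (i ≟ l) ×-dec ¬? (j ≟ l) ×-dec
          (col c i j ≟ col c i l) ×-dec (col c i j ≟ col c j l))

    good? : ∀ i j → Dec (Good i j)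
    good? i j = map′ (λ all l → All.lookup all (∈-allFin l)) (λ h → All.tabulate (λ {l} _ → h l))
                     (All.all? (goodAt? i j) (allFin n))

    goodEdgeᵇ≡good? : ∀ i j → goodEdgeᵇ c i j ≡ does (good? i j)
    goodEdgeᵇ≡good? i j = allᵇ≡all? (allFin n)
      where
      allᵇ≡all? : ∀ xs → allᵇ (λ l → does (goodAt? i j l)) xs ≡ does (All.all? (goodAt? i j) xs)
      allᵇ≡all? []       = refl
      allᵇ≡all? (x ∷ xs) rewrite allᵇ≡all? xs = refl

    goodCount≡ : goodCount c ≡ ∑ (allFin n) (λ i → ∑ (allFin n) (λ j → 𝟙 (i <?ᶠ j ×-dec good? i j)))
    goodCount≡ = countᵇ-edges good? _ goodEdgeᵇ≡good?

  -- Transfers the count to the pointwise equal colouring found in `allColorings`.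
  goodCount-mono : ∀ {k n} (c c′ : Coloring k n) → (∀ i j → c i j ≡ c′ i j) → goodCount c ≤ goodCount c′
  goodCount-mono {n = n} c c′ eq = begin
    goodCount c
      ≡⟨ goodCount≡ c ⟩
    ∑ (allFin n) (λ i → ∑ (allFin n) (λ j → 𝟙 (i <?ᶠ j ×-dec good? c i j)))
      ≤⟨ ∑-mono′ (allFin n) (λ i → ∑-mono′ (allFin n) λ j →
           𝟙-mono (i <?ᶠ j ×-dec good? c i j) (i <?ᶠ j ×-dec good? c′ i j) λ { (i<j , h) → i<j , transfer h }) ⟩
    ∑ (allFin n) (λ i → ∑ (allFin n) (λ j → 𝟙 (i <?ᶠ j ×-dec good? c′ i j)))
      ≡⟨ goodCount≡ c′ ⟨
    goodCount c′ ∎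
    where
    open ≤-Reasoning
    col-eq : ∀ i j → col c i j ≡ col c′ i j
    col-eq i j with i <?ᶠ j
    ... | yes i<j = trans (col-< c i<j) (trans (eq i j) (sym (col-< c′ i<j)))
    ... | no  i≮j = trans (col-≮ c i≮j) (trans (eq j i) (sym (col-≮ c′ i≮j)))
    transfer : ∀ {i j} → Good c i j → Good c′ i j
    transfer {i} {j} h l with h l
    ... | good rewrite col-eq i j | col-eq i l | col-eq j l = good

  ∈⇒≤maximum : ∀ {x xs} → x ∈ xs → x ≤ maximum xs
  ∈⇒≤maximum {xs = y ∷ ys} (here refl) = m≤m⊔n y (maximum ys)
  ∈⇒≤maximum {xs = y ∷ ys} (there x∈)  = ≤-trans (∈⇒≤maximum x∈) (m≤n⊔m y (maximum ys))

  maximum-map⁺ : (P : ℕ → Set) (h : A → ℕ) → P 0 → (∀ x → P (h x)) → ∀ xs → P (maximum (map h xs))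
  maximum-map⁺ P h p₀ p []       = p₀
  maximum-map⁺ P h p₀ p (x ∷ xs) with ⊔-sel (h x) (maximum (map h xs))
  ... | inj₁ e = subst P (sym e) (p x)
  ... | inj₂ e = subst P (sym e) (maximum-map⁺ P h p₀ p xs)

  -- Without function extensionality the list of all functions is complete only up to pointwise R.
  allFuns-complete : (R : A → A → Set) (m : ℕ) (xs : List A) (φ : Fin m → A) →
                     (∀ i → ∃[ x ] (x ∈ xs × R (φ i) x)) →
                     ∃[ ψ ] (ψ ∈ allFuns m xs × (∀ i → R (φ i) (ψ i)))
  allFuns-complete R zero    xs φ h = _ , here refl , λ ()
  allFuns-complete R (suc m) xs φ h with h zero | allFuns-complete R m xs (φ ∘ suc) (h ∘ suc)
  ... | x , x∈ , r | ψ , ψ∈ , rs =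
    _ , ∈-concatMap⁺ _ (lose x∈ (∈-map⁺ _ ψ∈)) , λ { zero → r ; (suc i) → rs i }

  goodCount≤f : ∀ {k n} (c : Coloring k n) → goodCount c ≤ f k n
  goodCount≤f {k} {n} c
    with allFuns-complete (λ h h′ → ∀ j → h j ≡ h′ j) n (allFuns n (allFin k)) c
           (λ i → allFuns-complete _≡_ n (allFin k) (c i) (λ j → c i j , ∈-allFin (c i j) , refl))
  ... | c′ , c′∈ , eq = ≤-trans (goodCount-mono c c′ eq) (∈⇒≤maximum (∈-map⁺ goodCount c′∈))

  f⁺ : ∀ {k n} (P : ℕ → Set) → P 0 → (∀ (c : Coloring k n) → P (goodCount c)) → P (f k n)
  f⁺ {k} {n} P p₀ p = maximum-map⁺ P goodCount p₀ p (allColorings k n)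

  module BlowUp {r k : ℕ} {χ : Fin (suc r) → Fin (suc r) → Fin k} (X : IsGallaiTriangleFree χ) (n : ℕ) where
    open IsGallaiTriangleFree X

    part : Fin n → Fin (suc r)
    part i = toℕ i mod suc r

    blowUp : Coloring (suc k) n
    blowUp i j with part i ≟ part j
    ... | yes _ = zero
    ... | no  _ = suc (χ (part i) (part j))

    blowUp-symm : ∀ i j → blowUp i j ≡ blowUp j i
    blowUp-symm i j with part i ≟ part j | part j ≟ part i
    ... | yes _ | yes _ = refl
    ... | yes e | no ne = contradiction (sym e) ne
    ... | no ne | yes e = contradiction (sym e) ne
    ... | no _  | no _  = cong suc (symm (part i) (part j))

    -- If `l` shares a part with one end, that part sends two edges of equal colour to the other
    -- end, while the third edge has the new colour `zero`; so the triangle is neither rainbow nor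
    -- monochromatic. Otherwise its colours are copied from `χ`.
    blowUp-good : ∀ i j → part i ≢ part j → Good blowUp i j
    blowUp-good i j pi≢pj l
      rewrite col-of-symmetric blowUp blowUp-symm i j
            | col-of-symmetric blowUp blowUp-symm i l
            | col-of-symmetric blowUp blowUp-symm j l
      with part i ≟ part j | part i ≟ part l | part j ≟ part l
    ... | yes e | _      | _      = contradiction e pi≢pj
    ... | no _  | yes e  | yes e′ = contradiction (trans e (sym e′)) pi≢pj
    ... | no _  | yes e  | no _   =
      (λ (_ , _ , _ , _ , ne , _) → ne (cong suc (trans (symm (part i) (part j)) (cong (χ (part j)) e)))) ,
      (λ { (_ , _ , _ , () , _) })
    ... | no _  | no _   | yes e  =
      (λ (_ , _ , _ , ne , _) → ne (cong suc (cong (χ (part i)) e))) ,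
      (λ { (_ , _ , _ , _ , ()) })
    ... | no ne | no ne′ | no ne″ =
      (λ (_ , _ , _ , p , q , s) → noRainbow ne ne′ ne″ (p ∘ cong suc) (q ∘ cong suc) (s ∘ cong suc)) ,
      (λ (_ , _ , _ , p , q) → noMono ne ne′ ne″ (suc-injective p) (suc-injective q))

    t≤goodCount : t n (suc r) ≤ goodCount blowUp
    t≤goodCount = begin
      t n (suc r)
        ≡⟨ t≡ n r ⟩
      ∑ (allFin n) (λ i → ∑ (allFin n) (λ j → 𝟙 (i <?ᶠ j ×-dec ¬? (samePart? r i j))))
        ≤⟨ ∑-mono′ (allFin n) (λ i → ∑-mono′ (allFin n) λ j →
             𝟙-mono (i <?ᶠ j ×-dec ¬? (samePart? r i j)) (i <?ᶠ j ×-dec good? blowUp i j)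
               λ { (i<j , ne) → i<j , blowUp-good i j (λ e → ne (trans (sym (toℕ-part i)) (trans (cong toℕ e) (toℕ-part j)))) }) ⟩
      ∑ (allFin n) (λ i → ∑ (allFin n) (λ j → 𝟙 (i <?ᶠ j ×-dec good? blowUp i j)))
        ≡⟨ goodCount≡ blowUp ⟨
      goodCount blowUp ∎
      where
      open ≤-Reasoning
      toℕ-part : ∀ i → toℕ (part i) ≡ toℕ i % suc r
      toℕ-part i = toℕ-fromℕ< _

  t≤f : ∀ {m k} {χ : Fin m → Fin m → Fin k} → IsGallaiTriangleFree χ → ∀ n → t n m ≤ f (suc k) n
  t≤f {zero}  _ n = z≤n
  t≤f {suc _} X n = ≤-trans (BlowUp.t≤goodCount X n) (goodCount≤f (BlowUp.blowUp X n))

  -- The upper bound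

  ∑∑ : ∀ {n} → (Fin n → Fin n → ℕ) → ℕ
  ∑∑ {n} h = ∑ (allFin n) (λ i → ∑ (allFin n) (h i))

  ∑∑-mono : ∀ {n} {h h′ : Fin n → Fin n → ℕ} → (∀ i j → h i j ≤ h′ i j) → ∑∑ h ≤ ∑∑ h′
  ∑∑-mono {n} le = ∑-mono′ (allFin n) (λ i → ∑-mono′ (allFin n) (le i))

  ∑∑-+ : ∀ {n} (h h′ : Fin n → Fin n → ℕ) → ∑∑ (λ i j → h i j + h′ i j) ≡ ∑∑ h + ∑∑ h′
  ∑∑-+ {n} h h′ = trans (∑-cong (allFin n) (λ i → ∑-+ (allFin n) (h i) (h′ i))) (∑-+ (allFin n) _ _)

  ∑∑-transpose : ∀ {n} (h : Fin n → Fin n → ℕ) → ∑∑ h ≡ ∑∑ (λ i j → h j i)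
  ∑∑-transpose {n} h = ∑-swap (allFin n) (allFin n) h

  2*∑∑ : ∀ {n} (h : Fin n → Fin n → ℕ) → 2 * ∑∑ h ≡ ∑∑ (λ i j → h i j + h j i)
  2*∑∑ h = trans (cong (∑∑ h +_) (trans (+-identityʳ _) (∑∑-transpose h))) (sym (∑∑-+ h (λ i j → h j i)))

  -- Ordered pairs in different parts are counted by `2 * t`. Members of one residue class are told
  -- apart by their quotients, so a class has at most `n / suc r + 1` members.
  turán-number-lower : ∀ n r → suc r * (n * n) ≤ suc r * (2 * t n (suc r)) + n * (n + suc r)
  turán-number-lower n r = begin
    suc r * (n * n)                                                     ≤⟨ *-monoʳ-≤ (suc r) pairs ⟩
    suc r * (2 * t n (suc r) + ∑∑ same)                                 ≡⟨ *-distribˡ-+ (suc r) (2 * t n (suc r)) (∑∑ same) ⟩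
    suc r * (2 * t n (suc r)) + suc r * ∑∑ same                         ≤⟨ +-monoʳ-≤ _ same≤ ⟩
    suc r * (2 * t n (suc r)) + n * (n + suc r)                         ∎
    where
    open ≤-Reasoning
    same apart : Fin n → Fin n → ℕ
    same i j = 𝟙 (samePart? r i j)
    apart i j = 𝟙 (i <?ᶠ j ×-dec ¬? (samePart? r i j))
    class≤ : ∀ i → ∑ (allFin n) (same i) ≤ suc (n / suc r)
    class≤ i = ∑𝟙-pigeonhole (samePart? r i) (allFin⁺ n) quotient injective
      where
      quotient< : ∀ (j : Fin n) → toℕ j / suc r < suc (n / suc r)
      quotient< j = s≤s (/-monoˡ-≤ (suc r) (<⇒≤ (toℕ<n j)))
      quotient : Fin n → Fin (suc (n / suc r))
      quotient j = fromℕ< (quotient< j)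
      injective : ∀ {x y} → SamePart r i x → SamePart r i y → quotient x ≡ quotient y → x ≡ y
      injective {x} {y} p q e = toℕ-injective (begin-equality
        toℕ x                                            ≡⟨ m≡m%n+[m/n]*n (toℕ x) (suc r) ⟩
        toℕ x % suc r + (toℕ x / suc r) * suc r          ≡⟨ cong₂ (λ a b → a + b * suc r) (trans (sym p) q)
            (trans (sym (toℕ-fromℕ< (quotient< x))) (trans (cong toℕ e) (toℕ-fromℕ< (quotient< y)))) ⟩
        toℕ y % suc r + (toℕ y / suc r) * suc r          ≡⟨ m≡m%n+[m/n]*n (toℕ y) (suc r) ⟨
        toℕ y                                            ∎)
    same≤ : suc r * ∑∑ same ≤ n * (n + suc r)
    same≤ = begin
      suc r * ∑∑ same                                ≤⟨ *-monoʳ-≤ (suc r) (∑-≤const (allFin n) class≤) ⟩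
      suc r * (length (allFin n) * suc (n / suc r))  ≡⟨ cong (λ m → suc r * (m * suc (n / suc r))) (length-allFin n) ⟩
      suc r * (n * suc (n / suc r))                  ≡⟨ rearrange r n (n / suc r) ⟩
      n * (n / suc r * suc r + suc r)                ≤⟨ *-monoʳ-≤ n (+-monoˡ-≤ (suc r) (m/n*n≤m n (suc r))) ⟩
      n * (n + suc r)                                ∎
      where
      rearrange : ∀ r n q → suc r * (n * suc q) ≡ n * (q * suc r + suc r)
      rearrange = solve-∀
    cover : ∀ i j → 1 ≤ (apart i j + apart j i) + same i j
    cover i j = cases (samePart? r i j) (<-cmp i j)
      where
      cases : Dec (SamePart r i j) → Tri (i <ᶠ j) (i ≡ j) (j <ᶠ i) → 1 ≤ (apart i j + apart j i) + same i j
      cases (yes e) _ = ≤-trans (≤-reflexive (sym (𝟙-yes (samePart? r i j) e))) (m≤n+m (same i j) _)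
      cases (no ne) (tri< i<j _ _) = ≤-trans
        (≤-reflexive (sym (𝟙-yes (i <?ᶠ j ×-dec ¬? (samePart? r i j)) (i<j , ne))))
        (≤-trans (m≤m+n (apart i j) (apart j i)) (m≤m+n _ (same i j)))
      cases (no ne) (tri≈ _ refl _) = contradiction refl ne
      cases (no ne) (tri> _ _ j<i) = ≤-trans
        (≤-reflexive (sym (𝟙-yes (j <?ᶠ i ×-dec ¬? (samePart? r j i)) (j<i , ne ∘ sym))))
        (≤-trans (m≤n+m (apart j i) (apart i j)) (m≤m+n _ (same i j)))
    pairs : n * n ≤ 2 * t n (suc r) + ∑∑ same
    pairs = begin
      n * n                                           ≡⟨ cong₂ _*_ (sym (length-allFin n)) (sym (trans (*-identityʳ _) (length-allFin n))) ⟩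
      length (allFin n) * (length (allFin n) * 1)     ≡⟨ ∑-const (allFin n) _ ⟨
      ∑ (allFin n) (λ _ → length (allFin n) * 1)      ≡⟨ ∑-cong (allFin n) (λ _ → sym (∑-const (allFin n) 1)) ⟩
      ∑∑ {n} (λ _ _ → 1)                              ≤⟨ ∑∑-mono cover ⟩
      ∑∑ (λ i j → (apart i j + apart j i) + same i j) ≡⟨ ∑∑-+ (λ i j → apart i j + apart j i) same ⟩
      ∑∑ (λ i j → apart i j + apart j i) + ∑∑ same    ≡⟨ cong (_+ ∑∑ same) (2*∑∑ apart) ⟨
      2 * ∑∑ apart + ∑∑ same                          ≡⟨ cong (λ m → 2 * m + ∑∑ same) (t≡ n r) ⟨
      2 * t n (suc r) + ∑∑ same                       ∎

  -- `D` stands for the number of ordered adjacent pairs and `T` for twice the Turán number; the two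
  -- bounds differ by at most `n`.
  turán-arithmetic : ∀ r n D T → suc r * D ≤ r * (n * n) →
                     suc r * (n * n) ≤ suc r * T + n * (n + suc r) → D ≤ T + n
  turán-arithmetic r n D T upper lower = *-cancelˡ-≤ (suc r) (+-cancelʳ-≤ (n * n) _ _ (begin
    suc r * D + n * n                ≤⟨ +-monoˡ-≤ (n * n) upper ⟩
    r * (n * n) + n * n              ≡⟨ +-comm (r * (n * n)) (n * n) ⟩
    suc r * (n * n)                  ≤⟨ lower ⟩
    suc r * T + n * (n + suc r)      ≡⟨ rearrange (suc r) T n ⟩
    suc r * (T + n) + n * n          ∎))
    where
    open ≤-Reasoning
    rearrange : ∀ r t n → r * t + n * (n + r) ≡ r * (t + n) + n * n
    rearrange = solve-∀

  -- For b > 0, the bounds with q = 2 b and p = q ^ k; the error terms add up to less than n² / b.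
  final-arithmetic : ∀ b p G T n D l → 2 * G ≤ D + 2 * l → D ≤ 2 * T + n →
                     2 * b * l ≤ n * n + p * (2 * b * n) → b + 2 * b * p < n →
                     b * G < b * T + n * n
  final-arithmetic b p G T n D l G≤ D≤ l≤ large = *-cancelˡ-< 4 _ _ (begin-strict
    4 * (b * G)                                                 ≡⟨ regroup₁ b G ⟩
    2 * b * (2 * G)                                             ≤⟨ *-monoʳ-≤ (2 * b) (≤-trans G≤ (+-monoˡ-≤ (2 * l) D≤)) ⟩
    2 * b * (2 * T + n + 2 * l)                                 ≡⟨ *-distribˡ-+ (2 * b) (2 * T + n) (2 * l) ⟩
    2 * b * (2 * T + n) + 2 * b * (2 * l)                       ≡⟨ cong (2 * b * (2 * T + n) +_) (regroup₂ (2 * b) l) ⟩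
    2 * b * (2 * T + n) + 2 * (2 * b * l)                       ≤⟨ +-monoʳ-≤ (2 * b * (2 * T + n)) (*-monoʳ-≤ 2 l≤) ⟩
    2 * b * (2 * T + n) + 2 * (n * n + p * (2 * b * n))         ≡⟨ regroup₃ b T n p ⟩
    4 * (b * T) + 2 * (n * n) + 2 * ((b + 2 * b * p) * n)       <⟨ +-monoʳ-< (4 * (b * T) + 2 * (n * n)) (*-monoʳ-< 2 (*-monoˡ-< n large)) ⟩
    4 * (b * T) + 2 * (n * n) + 2 * (n * n)                     ≡⟨ regroup₄ (b * T) (n * n) ⟩
    4 * (b * T + n * n)                                         ∎)
    where
    open ≤-Reasoning
    instance
      n≢0 : NonZero n
      n≢0 = >-nonZero (≤-trans (s≤s z≤n) large)
    regroup₁ : ∀ b G → 4 * (b * G) ≡ 2 * b * (2 * G)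
    regroup₁ = solve-∀
    regroup₂ : ∀ q l → q * (2 * l) ≡ 2 * (q * l)
    regroup₂ = solve-∀
    regroup₃ : ∀ b T n p → 2 * b * (2 * T + n) + 2 * (n * n + p * (2 * b * n))
                           ≡ 4 * (b * T) + 2 * (n * n) + 2 * ((b + 2 * b * p) * n)
    regroup₃ = solve-∀
    regroup₄ : ∀ x y → 4 * x + 2 * y + 2 * y ≡ 4 * (x + y)
    regroup₄ = solve-∀

  module Upper {k n : ℕ} (c : Coloring (suc k) n) where

    χ : Fin n → Fin n → Fin (suc k)
    χ = col c

    good-sym : ∀ {i j} → Good c i j → Good c j i
    good-sym {i} {j} h l with h l
    ... | ¬rainbow , ¬mono rewrite col-symm c j i =
      (λ (a , b , d , p , q , s) → ¬rainbow (a ∘ sym , d , b , q , p , s ∘ sym)) ,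
      (λ (a , b , d , p , q) → ¬mono (a ∘ sym , d , b , q , p))

    -- The first conjunct is needed because Good c u u holds vacuously.
    Edge : Fin n → Fin n → Set
    Edge u v = u ≢ v × Good c u v

    edge-sym : ∀ {u v} → Edge u v → Edge v u
    edge-sym (u≢v , good) = u≢v ∘ sym , good-sym good

    edge? : ∀ u v → Dec (Edge u v)
    edge? u v = ¬? (u ≟ v) ×-dec good? c u v

    Nbr : Fin (suc k) → Fin n → Fin n → Set
    Nbr a u x = Edge u x × χ u x ≡ a

    nbr? : ∀ a u x → Dec (Nbr a u x)
    nbr? a u x = edge? u x ×-dec χ u x ≟ a

    deg : Fin (suc k) → Fin n → ℕ
    deg a u = ∑ (allFin n) (λ x → 𝟙 (nbr? a u x))

    deg≤n : ∀ a u → deg a u ≤ n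
    deg≤n a u = ≤-trans (∑-≤const (allFin n) (λ x → 𝟙≤1 (nbr? a u x)))
      (≤-reflexive (trans (*-identityʳ _) (length-allFin n)))

    -- The vertices of U with a good edge of colour a to x span no edge of colour a, and for a
    -- suitable x they make up a proportion at least 1/q of U.
    heavy-bound : ∀ q (as : List (Fin (suc k))) (U : List (Fin n)) → Unique U →
                  (∀ {u} → u ∈ U → ∀ a → n ≤ q * deg a u) →
                  (∀ {u v} → u ∈ U → v ∈ U → u ≢ v → χ u v ∈ as) →
                  length U ≤ q ^ length as
    heavy-bound q as [] _ _ _ = z≤n
    heavy-bound q [] (_ ∷ []) _ _ _ = s≤s z≤n
    heavy-bound q [] (u ∷ v ∷ _) ((u≢v ∷ _) ∷ _) _ cols with cols (here refl) (there (here refl)) u≢v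
    ... | ()
    heavy-bound q (a ∷ as) U@(w ∷ _) uniq heavy cols = *-cancelʳ-≤ (length U) (q * q ^ length as) n ⦃ nonZero w ⦄ (begin
      length U * n                                           ≡⟨ ∑-const U n ⟨
      ∑ U (λ _ → n)                                          ≤⟨ ∑-mono U (λ u∈ → heavy u∈ a) ⟩
      ∑ U (λ u → q * deg a u)                                ≡⟨ ∑-*ˡ U q (deg a) ⟩
      q * ∑ U (deg a)                                        ≡⟨ cong (q *_) (∑-swap U (allFin n) _) ⟩
      q * ∑ (allFin n) (λ x → ∑ U (λ u → 𝟙 (nbr? a u x)))    ≡⟨ cong (q *_) (∑-cong (allFin n) λ x → sym (length-filter≡∑ (to? x) U)) ⟩
      q * ∑ (allFin n) (λ x → length (filter (to? x) U))     ≤⟨ *-monoʳ-≤ q (∑-≤const (allFin n) fibre) ⟩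
      q * (length (allFin n) * q ^ length as)                ≡⟨ cong (λ m → q * (m * q ^ length as)) (length-allFin n) ⟩
      q * (n * q ^ length as)                                ≡⟨ rearrange q n (q ^ length as) ⟩
      q * q ^ length as * n                                  ∎)
      where
      open ≤-Reasoning
      nonZero : ∀ {n} → Fin n → NonZero n
      nonZero zero    = _
      nonZero (suc _) = _
      rearrange : ∀ q n p → q * (n * p) ≡ q * p * n
      rearrange = solve-∀
      to? : ∀ x → Decidable (λ u → Nbr a u x)
      to? x u = nbr? a u x
      fibre : ∀ x → length (filter (to? x) U) ≤ q ^ length as
      fibre x = heavy-bound q as (filter (to? x) U) (filter⁺ (to? x) uniq) (λ u∈ → heavy (proj₁ (U⇒ u∈)))
        λ u∈ v∈ u≢v → drop-head (avoid u∈ v∈ u≢v) (cols (proj₁ (U⇒ u∈)) (proj₁ (U⇒ v∈)) u≢v)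
        where
        U⇒ : ∀ {u} → u ∈ filter (to? x) U → u ∈ U × Nbr a u x
        U⇒ = ∈-filter⁻ (to? x) {xs = U}
        drop-head : ∀ {b} → b ≢ a → b ∈ a ∷ as → b ∈ as
        drop-head ne (here e)   = contradiction e ne
        drop-head _  (there b∈) = b∈
        avoid : ∀ {u v} → u ∈ filter (to? x) U → v ∈ filter (to? x) U → u ≢ v → χ u v ≢ a
        avoid {u} {v} u∈ v∈ u≢v e with U⇒ u∈ | U⇒ v∈
        ... | _ , (u≢x , good) , ux | _ , (v≢x , _) , vx =
          -- The triangle `u`, `x`, `v` would be monochromatic although the edge `u x` is good.
          proj₂ (good v) (u≢x , u≢v , v≢x ∘ sym , trans ux (sym e) , trans ux (sym (trans (col-symm c x v) vx)))

    module _ (q : ℕ) where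

      Light : Fin n → Fin (suc k) → Set
      Light u a = q * deg a u < n

      light? : ∀ u → Dec (∃[ a ] Light u a)
      light? u = Finₚ.any? (λ a → q * deg a u <?ⁿ n)

      -- A colour of small good degree at u, with a junk value at the few vertices having none.
      γ : Fin n → Fin (suc k)
      γ u with light? u
      ... | yes (a , _) = a
      ... | no  _       = zero

      heavy : List (Fin n)
      heavy = filter (¬? ∘ light?) (allFin n)

      heavy≤ : length heavy ≤ q ^ suc k
      heavy≤ = ≤-trans
        (heavy-bound q (allFin (suc k)) heavy (filter⁺ (¬? ∘ light?) (allFin⁺ n))
          (λ u∈ a → ≮⇒≥ λ lt → proj₂ (∈-filter⁻ (¬? ∘ light?) {xs = allFin n} u∈) (a , lt))
          (λ _ _ _ → ∈-allFin _))
        (≤-reflexive (cong (q ^_) (length-allFin (suc k))))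

      lost : ℕ
      lost = ∑ (allFin n) (λ u → deg (γ u) u)

      -- A vertex with a light colour contributes less than `n` to `q * lost`; each of the at most
      -- `q ^ suc k` remaining ones contributes at most `q * n`.
      lost≤ : q * lost ≤ n * n + q ^ suc k * (q * n)
      lost≤ = begin
        q * lost                                                            ≡⟨ ∑-*ˡ (allFin n) q _ ⟨
        ∑ (allFin n) (λ u → q * deg (γ u) u)                                ≤⟨ ∑-mono′ (allFin n) pointwise ⟩
        ∑ (allFin n) (λ u → n + q * n * 𝟙 (¬? (light? u)))                  ≡⟨ ∑-+ (allFin n) (λ _ → n) _ ⟩
        ∑ (allFin n) (λ _ → n) + ∑ (allFin n) (λ u → q * n * 𝟙 (¬? (light? u)))
          ≡⟨ cong₂ _+_ (trans (∑-const (allFin n) n) (cong (_* n) (length-allFin n))) (∑-*ˡ (allFin n) (q * n) _) ⟩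
        n * n + q * n * ∑ (allFin n) (λ u → 𝟙 (¬? (light? u)))              ≡⟨ cong (λ m → n * n + q * n * m) (length-filter≡∑ (¬? ∘ light?) (allFin n)) ⟨
        n * n + q * n * length heavy                                        ≤⟨ +-monoʳ-≤ (n * n) (*-monoʳ-≤ (q * n) heavy≤) ⟩
        n * n + q * n * q ^ suc k                                           ≡⟨ cong (n * n +_) (*-comm (q * n) _) ⟩
        n * n + q ^ suc k * (q * n)                                         ∎
        where
        open ≤-Reasoning
        pointwise : ∀ u → q * deg (γ u) u ≤ n + q * n * 𝟙 (¬? (light? u))
        pointwise u with light? u
        ... | yes (a , lt) = ≤-trans (<⇒≤ lt) (m≤m+n n _)
        ... | no _ = ≤-trans (*-monoʳ-≤ q (deg≤n zero u)) (≤-trans (≤-reflexive (sym (*-identityʳ (q * n)))) (m≤n+m _ n))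

      Kept : Fin n → Fin n → Set
      Kept u v = Edge u v × χ u v ≢ γ u × χ u v ≢ γ v

      kept? : ∀ u v → Dec (Kept u v)
      kept? u v = edge? u v ×-dec ¬? (χ u v ≟ γ u) ×-dec ¬? (χ u v ≟ γ v)

      kept-sym : ∀ {u v} → Kept u v → Kept v u
      kept-sym {u} {v} (e , p , q) = edge-sym e , (q ∘ trans (col-symm c u v)) , (p ∘ trans (col-symm c u v))

      open Turán Kept kept? kept-sym

      -- All edges of a clique are good, so it carries a Gallai colouring without monochromatic
      -- triangles in which `γ (e i)` is missing at `e i`; hence its order is at most `g k`.
      kept-cliqueFree : CliqueFree (suc (g k)) (allFin n)
      kept-cliqueFree e _ clique = <⇒≱ ≤-refl (size≤g-missing {χ = λ i j → χ (e i) (e j)}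
        (record
          { isGallai = record
            { symm      = λ i j → col-symm c (e i) (e j)
            ; noRainbow = λ i≢j i≢l j≢l p q s → proj₁ (proj₂ (proj₁ (clique i≢j)) _)
                (≢e i≢j , ≢e i≢l , ≢e j≢l , p , q , s) }
          ; noMono = λ i≢j i≢l j≢l p q → proj₂ (proj₂ (proj₁ (clique i≢j)) _)
              (≢e i≢j , ≢e i≢l , ≢e j≢l , p , q) })
        (γ ∘ e) (λ i≢j → proj₁ (proj₂ (clique i≢j))))
        where
        ≢e : ∀ {i j} → i ≢ j → e i ≢ e j
        ≢e i≢j = proj₁ (proj₁ (clique i≢j))

      -- A good edge that is not kept has the colour `γ` of one of its ends and is counted in `lost`
      -- from there.
      2*goodCount≤ : 2 * goodCount c ≤ edgesBetween (allFin n) (allFin n) + 2 * lost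
      2*goodCount≤ = begin
        2 * goodCount c                                  ≡⟨ cong (2 *_) (goodCount≡ c) ⟩
        2 * ∑∑ oriented                                  ≡⟨ 2*∑∑ oriented ⟩
        ∑∑ (λ u v → oriented u v + oriented v u)         ≤⟨ ∑∑-mono pointwise ⟩
        ∑∑ (λ u v → 𝟙 (kept? u v) + (light u v + light v u))  ≡⟨ ∑∑-+ (λ u v → 𝟙 (kept? u v)) _ ⟩
        ∑∑ (λ u v → 𝟙 (kept? u v)) + ∑∑ (λ u v → light u v + light v u)  ≡⟨ cong (∑∑ (λ u v → 𝟙 (kept? u v)) +_) (2*∑∑ light) ⟨
        ∑∑ (λ u v → 𝟙 (kept? u v)) + 2 * lost            ∎
        where
        open ≤-Reasoning
        oriented light : Fin n → Fin n → ℕ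
        oriented u v = 𝟙 (u <?ᶠ v ×-dec good? c u v)
        light u v = 𝟙 (nbr? (γ u) u v)
        oriented≤ : ∀ u v → oriented u v + oriented v u ≤ 𝟙 (edge? u v)
        oriented≤ u v = 𝟙-disjoint (u <?ᶠ v ×-dec good? c u v) (v <?ᶠ u ×-dec good? c v u) (edge? u v)
          (λ (u<v , h) → (λ { refl → <-irrefl refl u<v }) , h)
          (λ (v<u , h) → (λ { refl → <-irrefl refl v<u }) , good-sym h)
          (λ (u<v , _) (v<u , _) → <-asym u<v v<u)
        pointwise : ∀ u v → oriented u v + oriented v u ≤ 𝟙 (kept? u v) + (light u v + light v u)
        pointwise u v = ≤-trans (oriented≤ u v) (cases (edge? u v) (χ u v ≟ γ u) (χ u v ≟ γ v))
          where
          cases : (e : Dec (Edge u v)) → Dec (χ u v ≡ γ u) → Dec (χ u v ≡ γ v) →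
                  𝟙 e ≤ 𝟙 (kept? u v) + (light u v + light v u)
          cases (no _)  _       _       = z≤n
          cases (yes e) (yes p) _       = ≤-trans (≤-reflexive (sym (𝟙-yes (nbr? (γ u) u v) (e , p))))
            (≤-trans (m≤m+n _ (light v u)) (m≤n+m _ (𝟙 (kept? u v))))
          cases (yes e) (no _)  (yes p) = ≤-trans (≤-reflexive (sym (𝟙-yes (nbr? (γ v) v u) (edge-sym e , trans (col-symm c v u) p))))
            (≤-trans (m≤n+m _ (light u v)) (m≤n+m _ (𝟙 (kept? u v))))
          cases (yes e) (no p)  (no p′) = ≤-trans (≤-reflexive (sym (𝟙-yes (kept? u v) (e , p , p′)))) (m≤m+n _ _)

      kept≤ : edgesBetween (allFin n) (allFin n) ≤ 2 * t n (g k) + n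
      kept≤ = subtract-diagonal (g k) (1≤g k) kept-cliqueFree
        where
        -- Replacing `g k` by a variable allows the match on `suc r`, the shape that `t` and the
        -- arithmetic require.
        subtract-diagonal : ∀ r → 1 ≤ r → CliqueFree (suc r) (allFin n) →
                            edgesBetween (allFin n) (allFin n) ≤ 2 * t n r + n
        subtract-diagonal (suc r) _ free = turán-arithmetic r n _ _
          (≤-trans (turán r (allFin n) free) (≤-reflexive (cong (λ m → r * (m * m)) (length-allFin n))))
          (turán-number-lower n r)

    -- The choice is `q = 2 * suc b`; the power in the hypothesis is `q` times the bound `q ^ suc k`
    -- on the number of heavy vertices.
    goodCount< : ∀ b → suc b + (2 * suc b) ^ suc (suc k) < n →
                 suc b * goodCount c < suc b * t n (g k) + n * n
    goodCount< b large = final-arithmetic (suc b) ((2 * suc b) ^ suc k) (goodCount c) (t n (g k)) n _ (lost (2 * suc b))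
      (2*goodCount≤ (2 * suc b)) (kept≤ (2 * suc b)) (lost≤ (2 * suc b)) large

  -- The exponent is one more than the number `2 + k` of colours, and the outer `suc` provides the
  -- strict inequality.
  threshold : ℕ → ℕ → ℕ
  threshold k b = suc (suc b + (2 * suc b) ^ (3 + k))

  f-bounds : ∀ {k N} → IsGR (suc k) N → ∀ b n → threshold k b ≤ n →
             t n (N ∸ 1) ≤ f (2 + k) n × suc b * f (2 + k) n < suc b * t n (N ∸ 1) + n * n
  f-bounds {k} gr b n large with IsGR⇒≡ gr
  ... | refl = t≤f (proj₂ (optimal k)) n , f⁺ (λ m → suc b * m < suc b * t n (g (suc k)) + n * n) f>0 (λ c → Upper.goodCount< c b large)
    where
    1≤n : 1 ≤ n
    1≤n = ≤-trans (s≤s z≤n) large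
    -- The default value 0 of `maximum` must also satisfy the strict bound, which holds because
    -- `n * n` is positive.
    f>0 : suc b * 0 < suc b * t n (g (suc k)) + n * n
    f>0 = ≤-trans (≤-reflexive (cong suc (*-zeroʳ (suc b)))) (≤-trans (*-mono-≤ 1≤n 1≤n) (m≤n+m _ _))

-- Passage to rational `δ`

open import Defs
open import Data.Nat using (ℕ; _≤_; _∸_; _*_)
open import Data.Integer using (+_)
open import Data.Rational using (ℚ; _/_; 0ℚ; _<_; _+_) renaming (_*_ to _*ℚ_)
open import Data.Product using (∃-syntax; _×_)
open import Data.Integer as ℤ using (+[1+_]; -[1+_])
open import Data.Nat as ℕ using (suc; s≤s)
open import Data.Product using (_,_; proj₁; proj₂)
open import Data.Rational using (mkℚ; toℚᵘ; *<*)
open import Data.Rational.Properties using (toℚᵘ-cancel-<; toℚᵘ-homo-+; toℚᵘ-homo-*; toℚᵘ-fromℚᵘ)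
open import Relation.Binary.PropositionalEquality using (_≡_; sym; trans; cong; cong₂; subst₂)
import Data.Integer.Properties as ℤₚ
import Data.Nat.Properties as ℕₚ
import Data.Rational.Unnormalised as ℚᵘ
import Data.Rational.Unnormalised.Properties as ℚᵘₚ
open GallaiRamsey using (threshold; f-bounds)

-- A positive `δ` with denominator `suc b` is at least `1 / suc b`. The witness `b` depends on `δ`
-- alone, so it can determine the threshold.
ℕ<⇒ℚ< : (δ : ℚ) → 0ℚ < δ →
        ∃[ b ] (∀ x y z → suc b ℕ.* x ℕ.< suc b ℕ.* y ℕ.+ z → (+ x / 1) < ((+ y / 1) + (δ *ℚ (+ z / 1))))
ℕ<⇒ℚ< δ@(mkℚ +[1+ a ] b _) _ = b , λ x y z lt → toℚᵘ-cancel-< (begin-strict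
  toℚᵘ (+ x / 1)                                    ≃⟨ toℚᵘ-fromℚᵘ (whole x) ⟩
  whole x                                           <⟨ core x y z lt ⟩
  whole y ℚᵘ.+ toℚᵘ δ ℚᵘ.* whole z
    ≃⟨ ℚᵘₚ.+-cong (ℚᵘₚ.≃-sym (toℚᵘ-fromℚᵘ (whole y)))
                  (ℚᵘₚ.≃-trans (ℚᵘₚ.*-congˡ {toℚᵘ δ} (ℚᵘₚ.≃-sym (toℚᵘ-fromℚᵘ (whole z)))) (ℚᵘₚ.≃-sym (toℚᵘ-homo-* δ (+ z / 1)))) ⟩
  toℚᵘ (+ y / 1) ℚᵘ.+ toℚᵘ (δ *ℚ (+ z / 1))         ≃⟨ toℚᵘ-homo-+ (+ y / 1) (δ *ℚ (+ z / 1)) ⟨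
  toℚᵘ ((+ y / 1) + (δ *ℚ (+ z / 1)))               ∎)
  where
  open ℚᵘₚ.≤-Reasoning
  whole : ℕ → ℚᵘ.ℚᵘ
  whole m = ℚᵘ.mkℚᵘ (+ m) 0
  core : ∀ x y z → suc b ℕ.* x ℕ.< suc b ℕ.* y ℕ.+ z →
         whole x ℚᵘ.< whole y ℚᵘ.+ toℚᵘ δ ℚᵘ.* whole z
  core x y z lt = ℚᵘ.*<* (subst₂ ℤ._<_ left right (ℤ.+<+ lt′))
    where
    -- The numerator `suc a` is at least 1, so `z` may be replaced by `suc a * z`.
    lt′ : x ℕ.* suc b ℕ.< y ℕ.* suc b ℕ.+ suc a ℕ.* z
    lt′ = ℕₚ.<-≤-trans (subst₂ ℕ._<_ (ℕₚ.*-comm (suc b) x) (cong (ℕ._+ z) (ℕₚ.*-comm (suc b) y)) lt)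
                       (ℕₚ.+-monoʳ-≤ (y ℕ.* suc b) (ℕₚ.m≤m+n z (a ℕ.* z)))
    left : + (x ℕ.* suc b) ≡ + x ℤ.* ℚᵘ.↧ (whole y ℚᵘ.+ toℚᵘ δ ℚᵘ.* whole z)
    left = trans (ℤₚ.pos-* x (suc b)) (cong (λ m → + x ℤ.* + m) (sym (trans (ℕₚ.*-identityˡ _) (ℕₚ.*-identityʳ (suc b)))))
    right : + (y ℕ.* suc b ℕ.+ suc a ℕ.* z) ≡ ℚᵘ.↥ (whole y ℚᵘ.+ toℚᵘ δ ℚᵘ.* whole z) ℤ.* + 1
    right = sym (trans (ℤₚ.*-identityʳ _) (trans
      (cong₂ ℤ._+_ (cong (λ m → + y ℤ.* + m) (ℕₚ.*-identityʳ (suc b))) (ℤₚ.*-identityʳ (+ suc a ℤ.* + z)))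
      (sym (trans (ℤₚ.pos-+ (y ℕ.* suc b) (suc a ℕ.* z)) (cong₂ ℤ._+_ (ℤₚ.pos-* y (suc b)) (ℤₚ.pos-* (suc a) z))))))
ℕ<⇒ℚ< (mkℚ (+ 0) _ _) (*<* (ℤ.+<+ ()))
ℕ<⇒ℚ< (mkℚ -[1+ _ ] _ _) (*<* ())

theorem1p1 : (k : ℕ) → 2 ≤ k → (N : ℕ) → IsGR (k ∸ 1) N →
    (δ : ℚ) → 0ℚ < δ →
    ∃[ n₀ ] ((n : ℕ) → n₀ ≤ n →
    (t n (N ∸ 1) ≤ f k n) ×
    ((+ f k n / 1) < ((+ t n (N ∸ 1) / 1) + (δ *ℚ (+ (n * n) / 1)))))
theorem1p1 (suc (suc k)) _ N gr δ 0<δ = threshold k b , λ n large →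
  let lower , upper = f-bounds gr b n large in
  lower , proj₂ (ℕ<⇒ℚ< δ 0<δ) (f (suc (suc k)) n) (t n (N ∸ 1)) (n * n) upper
  where
  b = proj₁ (ℕ<⇒ℚ< δ 0<δ)
theorem1p1 1 (s≤s ())
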